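{- Let $p$ be an odd prime and $n$ a positive integer. Then $$S_{np}-S_n\equiv\begin{cases} 8n^2S_{n-1}(-1)^{\frac{p-1}{2}}p^2E_{p-3}\pmod{p^3} & \text{if } p>3 \text{ and } p\nmid n,\\ 9(n-1)S_n \pmod{p^3} & \text{if } p=3 \text{ and } 3\nmid n,\\ 0 \pmod{p^{3+\mathrm{ord}_p n}} & \text{if } p\mid n.\end{cases}$$
   Context: $(S_n)_{n\ge0}$ is the integer sequence defined by $S_0=1$, $S_1=4$ and $(n+1)^2S_{n+1}=4(3n^2+3n+1)S_n-32n^2S_{n-1}$ for $n\ge1$; equivalently $S_n=\sum_{k=0}^n\binom nk\binom{2k}k\binom{2n-2k}{n-k}$. The Euler numbers $E_n$ are defined by $E_0=1$, $E_{2n-1}=0$ and $\sum_{k=0}^n\binom{2n}{2k}E_{2k}=0$ for $n\ge1$. For a positive integer $n$, $\mathrm{ord}_p n$ is the largest integer $\alpha\ge0$ with $p^\alpha\mid n$. -}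

module Defs where

open import Data.Fin.Base using (toℕ)
open import Data.Integer.Base using (ℤ; +_; 0ℤ; 1ℤ; _+_; _-_; _*_)
open import Data.Integer.Divisibility using (_∣_)
open import Data.Integer.Properties using (+-0-monoid)
open import Data.Nat.Base as ℕ using (ℕ; suc; pred; NonZero)
open import Data.Nat.Combinatorics using (_C_)
import Data.Nat.Divisibility as ℕ
open import Data.Product.Base using (_×_)
open import Relation.Binary.PropositionalEquality.Core using (_≡_)

open import Algebra.Properties.Monoid.Sum +-0-monoid using (sum⁺-syntax)

infix 4 _≡_[mod_]

_≡_[mod_] : ℤ → ℤ → ℕ → Set
a ≡ b [mod m ] = + m ∣ a - b

-- "S is the sequence (Sₙ)".  The recurrence determines Sₙ₊₁ because
-- (n+1)² ≠ 0; that integer values S satisfying it exist follows from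
--   Sₙ = ∑_{k ≤ n} C(n,k) C(2k,k) C(2n-2k,n-k).

record IsAperyLikeS (S : ℕ → ℤ) : Set where
  field
    S₀   : S 0 ≡ + 1
    S₁   : S 1 ≡ + 4
    Sₙ₊₁ : ∀ n .{{_ : NonZero n}} →
           + (suc n ℕ.^ 2) * S (suc n) ≡
             + (4 ℕ.* (3 ℕ.* n ℕ.^ 2 ℕ.+ 3 ℕ.* n ℕ.+ 1)) * S n
               - + (32 ℕ.* n ℕ.^ 2) * S (pred n)

record IsEuler (E : ℕ → ℤ) : Set where
  field
    E₀     : E 0 ≡ 1ℤ
    E₂ₙ₋₁  : ∀ n .{{_ : NonZero n}} → E (pred (2 ℕ.* n)) ≡ 0ℤ
    ∑E₂ₖ≡0 : ∀ n .{{_ : NonZero n}} →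
             ∑[ k ≤ n ] (+ ((2 ℕ.* n) C (2 ℕ.* toℕ k)) * E (2 ℕ.* toℕ k)) ≡ 0ℤ

-- α = ord_p n; such an α exists exactly when p ≠ 1 and n ≠ 0.

IsOrd : ℕ → ℕ → ℕ → Set
IsOrd p n α = (p ℕ.^ α ℕ.∣ n) × (∀ β → p ℕ.^ β ℕ.∣ n → β ℕ.≤ α)

{-# OPTIONS --safe #-}
-- With b(k) = C(2k, k), the sequence is Sₙ = ∑ C(n, k) b(k) b(n - k), the binomial convolution
-- b ⋆ b: the differential equation of the generating function of b yields the recurrence.
-- In S(np) the terms with p ∣ k give Sₙ up to an error governed by Jacobsthal's congruence and
-- proportional to κ = - ∑_{s < p/2} s^(p-3), which vanishes modulo p for p > 3.  The terms with
-- k = rp + s, 0 < s < p/2, are n p² (-1)^s s⁻² C(n-1, r) b(r) (n-r) b(n-r) modulo p³, because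
-- s b(s) b(Mp - s) ≡ - p M b(M) modulo p²; they are half of the rest, k ↦ np - k being a symmetry.
-- Summed over r they give 2 n² p² Sₙ₋₁ (-1)^s s⁻², and the sum of (-1)^s s^(p-3) is evaluated by
-- telescoping Euler polynomials.  All congruences hold modulo p³ q for the exact power q of
-- p dividing n, so that p ∣ n needs no separate argument, and for p = 3 the remaining
-- multiple of 9 is reduced by the recurrence.
module Submission where

open import Defs
open import Algebra.Bundles using (CommutativeMonoid)
open import Algebra.Properties.Monoid.Sum using (sum)
open import Data.Empty using (⊥-elim)
open import Data.Fin.Base using (toℕ)
open import Data.Integer.Base using (ℤ; +_; -1ℤ; 0ℤ; 1ℤ; _-_; _*_; _^_)
open import Data.Integer.Base as ℤ using (_+_; -_; ∣_∣)
open import Data.Integer.Divisibility.Signed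
  using ( divides; quotient; ∣⇒∣ᵤ; ∣ᵤ⇒∣; ∣-refl; ∣-trans; ∣m⇒∣-m; ∣m⇒∣m*n; ∣n⇒∣m*n
        ; ∣m∣n⇒∣m+n; ∣m∣n⇒∣m-n; ∣m+n∣m⇒∣n; ∣m+n∣n⇒∣m; *-monoˡ-∣; *-cancelʳ-∣ )
  renaming (_∣_ to _∣ℤ_)
open import Data.Integer.Properties
  using ( +-0-monoid; +-0-commutativeMonoid; *-1-commutativeMonoid
        ; +-assoc; +-comm; +-identityʳ; +-inverseʳ; +-injective
        ; *-assoc; *-comm; *-identityˡ; *-identityʳ; *-zeroˡ; *-zeroʳ
        ; *-distribˡ-+; *-distribʳ-+; *-cancelˡ-≡; *-cancelʳ-≡; suc-*; i*j≢0
        ; pos-*; abs-*; neg-involutive; ^-zeroˡ; ^-distribˡ-+-* )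
open import Data.Integer.Tactic.RingSolver using (solve-∀)
open import Data.Nat.Base as ℕ using (ℕ; NonZero; pred; _∸_; _/_; _>_)
open import Data.Nat.Base using (zero; suc; z≤n; s≤s; _!)
open import Data.Nat.Combinatorics
  using (_C_; nCn≡1; nCk≡nC[n∸k]; k>n⇒nCk≡0; nCk+nC[k+1]≡[n+1]C[k+1]; k![n∸k]!∣n!; nCk≡n!/k![n-k]!)
open import Data.Nat.Divisibility using (_∣_; _∤_)
import Data.Nat.Divisibility as ℕ
import Data.Nat.DivMod as ℕ
import Data.Nat.Properties as ℕ
open import Data.Nat.Primality using (Prime; euclidsLemma; prime⇒nonZero; ¬prime[1])
open import Data.Product.Base using (_×_; _,_; proj₁; proj₂; ∃-syntax)
open import Data.Sum.Base using (_⊎_; inj₁; inj₂)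
open import Function.Base using (_∋_; _∘_)
open import Relation.Binary.Bundles using (Setoid)
open import Relation.Binary.PropositionalEquality
  using (_≡_; _≗_; refl; sym; trans; cong; cong₂; subst; subst₂; module ≡-Reasoning)
open import Relation.Nullary using (¬_)

-- Sums and products over initial segments

-- No fractions occur: an inverse of s² modulo p is s^(p-3), by Fermat, and factors prime to p are
-- removed by cancellation. The delicate division is the one by n, which p may divide. There the
-- modulus keeps q: n divides C(n, r) r and C(n, r) (n - r) although it need not divide r, so an
-- error p³ r becomes a multiple of p³ q once the weight C(n, r) is attached. Only s < p/2 is
-- treated directly, because then b(s) is prime to p while b(Mp - s) is divisible by p, so that the
-- cofactors of the latter are needed to one power of p less. The identities behind the recurrence
-- serve twice. The value of b ⋆ D (θ b) also evaluates the sum over r of the terms with p ∤ k, and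
-- θ b ⋆ θ b is the part of the Jacobsthal error that depends on r (n - r). The constant 8 is 2 · 2
-- · 2: the symmetry k ↦ np - k, the value 2 n Sₙ₋₁ of that sum over r, and the factor 2 in the
-- Euler evaluation of ∑ (-1)^s s^(p-3).

module RangeFold {c ℓ} (M : CommutativeMonoid c ℓ) where
  open CommutativeMonoid M renaming (refl to ≈-refl; sym to ≈-sym; trans to ≈-trans)

  fold< : ℕ → (ℕ → Carrier) → Carrier
  fold< zero    f = ε
  fold< (suc n) f = fold< n f ∙ f n

  fold<-cong : ∀ n {f g} → (∀ i → i ℕ.< n → f i ≈ g i) → fold< n f ≈ fold< n g
  fold<-cong zero    eq = ≈-refl
  fold<-cong (suc n) eq =
    ∙-cong (fold<-cong n λ i i<n → eq i (ℕ.m<n⇒m<1+n i<n)) (eq n (ℕ.n<1+n n))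

  fold<-merge : ∀ n f g → fold< n f ∙ fold< n g ≈ fold< n (λ i → f i ∙ g i)
  fold<-merge zero    f g = identityˡ ε
  fold<-merge (suc n) f g = ≈-trans (interchange _ _ _ _) (∙-congʳ (fold<-merge n f g))
    where open import Algebra.Properties.CommutativeSemigroup commutativeSemigroup

  fold<-first : ∀ n f → fold< (suc n) f ≈ f 0 ∙ fold< n (f ∘ suc)
  fold<-first zero    f = comm _ _
  fold<-first (suc n) f = ≈-trans (∙-congʳ (fold<-first n f)) (assoc _ _ _)

  fold<-append : ∀ m n f → fold< (m ℕ.+ n) f ≈ fold< m f ∙ fold< n (λ i → f (m ℕ.+ i))
  fold<-append m zero    f rewrite ℕ.+-identityʳ m = ≈-sym (identityʳ _)
  fold<-append m (suc n) f rewrite ℕ.+-suc m n =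
    ≈-trans (∙-congʳ (fold<-append m n f)) (assoc _ _ _)

  fold<-reverse : ∀ n f → fold< n f ≈ fold< n (λ i → f (n ∸ suc i))
  fold<-reverse zero    f = ≈-refl
  fold<-reverse (suc n) f = ≈-trans (∙-congʳ (fold<-reverse n f))
    (≈-trans (comm _ _) (≈-sym (fold<-first n (λ i → f (n ∸ i)))))

  fold<-blocks : ∀ n p f →
    fold< (n ℕ.* p) f ≈ fold< n (λ r → fold< p (λ i → f (r ℕ.* p ℕ.+ i)))
  fold<-blocks zero    p f = ≈-refl
  fold<-blocks (suc n) p f rewrite ℕ.+-comm p (n ℕ.* p) =
    ≈-trans (fold<-append (n ℕ.* p) p f) (∙-congʳ (fold<-blocks n p f))

  fold<-ε : ∀ n → fold< n (λ _ → ε) ≈ ε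
  fold<-ε zero    = ≈-refl
  fold<-ε (suc n) = ≈-trans (identityʳ _) (fold<-ε n)

  fold<-swap : ∀ m n (f : ℕ → ℕ → Carrier) →
    fold< m (λ i → fold< n (f i)) ≈ fold< n (λ j → fold< m (λ i → f i j))
  fold<-swap zero    n f = ≈-sym (fold<-ε n)
  fold<-swap (suc m) n f =
    ≈-trans (∙-congʳ (fold<-swap m n f)) (fold<-merge n _ _)

open RangeFold +-0-commutativeMonoid public renaming
  ( fold< to ∑<; fold<-cong to ∑-cong; fold<-merge to ∑-+; fold<-first to ∑-first
  ; fold<-append to ∑-append; fold<-reverse to ∑-reverse; fold<-blocks to ∑-blocks
  ; fold<-swap to ∑-swap; fold<-ε to ∑-0 )

open RangeFold *-1-commutativeMonoid public using () renaming
  ( fold< to ∏<; fold<-cong to ∏-cong; fold<-merge to ∏-*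
  ; fold<-append to ∏-append; fold<-reverse to ∏-reverse )

∑-*ˡ : ∀ n c f → c * ∑< n f ≡ ∑< n (λ i → c * f i)
∑-*ˡ zero    c f = *-zeroʳ c
∑-*ˡ (suc n) c f = trans (*-distribˡ-+ c (∑< n f) (f n)) (cong (_+ c * f n) (∑-*ˡ n c f))

-- Binomial convolution

Seq : Set
Seq = ℕ → ℤ

infixl 6 _⊕_
infixr 7 _·_
infixl 7 _⋆_

_⊕_ : Seq → Seq → Seq
(u ⊕ v) n = u n + v n

_·_ : ℤ → Seq → Seq
(c · u) n = c * u n

-- Sequences stand for exponential generating functions: D, θ and ξ are
-- differentiation, x d/dx and multiplication by x, and ⋆ is the product,
-- defined through the Leibniz rule.

D θ ξ : Seq → Seq
D u n = u (suc n)
θ u n = + n * u n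
ξ u zero    = 0ℤ
ξ u (suc n) = + suc n * u n

_⋆_ : Seq → Seq → Seq
(u ⋆ v) zero    = u 0 * v 0
(u ⋆ v) (suc n) = (D u ⋆ v) n + (u ⋆ D v) n

⋆-cong : ∀ {u u′ v v′} → u ≗ u′ → v ≗ v′ → u ⋆ v ≗ u′ ⋆ v′
⋆-cong p q zero    = cong₂ _*_ (p 0) (q 0)
⋆-cong p q (suc n) =
  cong₂ _+_ (⋆-cong (p ∘ suc) q n) (⋆-cong p (q ∘ suc) n)

⋆-congˡ : ∀ u {v v′} → v ≗ v′ → u ⋆ v ≗ u ⋆ v′
⋆-congˡ u = ⋆-cong {u} λ _ → refl

⋆-comm : ∀ u v → u ⋆ v ≗ v ⋆ u
⋆-comm u v zero    = *-comm (u 0) (v 0)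
⋆-comm u v (suc n) = trans (cong₂ _+_ (⋆-comm (D u) v n) (⋆-comm u (D v) n))
                           (+-comm ((v ⋆ D u) n) ((D v ⋆ u) n))

⋆-distribˡ : ∀ u v w → u ⋆ (v ⊕ w) ≗ u ⋆ v ⊕ u ⋆ w
⋆-distribˡ u v w zero    = *-distribˡ-+ (u 0) (v 0) (w 0)
⋆-distribˡ u v w (suc n) =
  trans (cong₂ _+_ (⋆-distribˡ (D u) v w n) (⋆-distribˡ u (D v) (D w) n))
        (((∀ a b c d → (a + b) + (c + d) ≡ (a + c) + (b + d)) ∋ solve-∀)
          ((D u ⋆ v) n) ((D u ⋆ w) n) ((u ⋆ D v) n) ((u ⋆ D w) n))

⋆-·ʳ : ∀ c u v → u ⋆ (c · v) ≗ c · (u ⋆ v)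
⋆-·ʳ c u v zero    = ((∀ a b c → a * (b * c) ≡ b * (a * c)) ∋ solve-∀) (u 0) c (v 0)
⋆-·ʳ c u v (suc n) = trans (cong₂ _+_ (⋆-·ʳ c (D u) v n) (⋆-·ʳ c u (D v) n))
                           (sym (*-distribˡ-+ c ((D u ⋆ v) n) ((u ⋆ D v) n)))

⋆-distribʳ : ∀ u v w → (v ⊕ w) ⋆ u ≗ v ⋆ u ⊕ w ⋆ u
⋆-distribʳ u v w n = trans (⋆-comm (v ⊕ w) u n)
  (trans (⋆-distribˡ u v w n) (cong₂ _+_ (⋆-comm u v n) (⋆-comm u w n)))

⋆-·ˡ : ∀ c u v → (c · u) ⋆ v ≗ c · (u ⋆ v)
⋆-·ˡ c u v n = trans (⋆-comm (c · u) v n)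
  (trans (⋆-·ʳ c v u n) (cong (c *_) (⋆-comm v u n)))

⋆-assoc : ∀ u v w → (u ⋆ v) ⋆ w ≗ u ⋆ (v ⋆ w)
⋆-assoc u v w zero    = *-assoc (u 0) (v 0) (w 0)
⋆-assoc u v w (suc n) = begin
  ((D u ⋆ v ⊕ u ⋆ D v) ⋆ w) n + ((u ⋆ v) ⋆ D w) n
    ≡⟨ cong₂ _+_ (trans (⋆-distribʳ w (D u ⋆ v) (u ⋆ D v) n)
         (cong₂ _+_ (⋆-assoc (D u) v w n) (⋆-assoc u (D v) w n))) (⋆-assoc u v (D w) n) ⟩
  ((D u ⋆ (v ⋆ w)) n + (u ⋆ (D v ⋆ w)) n) + (u ⋆ (v ⋆ D w)) n
    ≡⟨ +-assoc ((D u ⋆ (v ⋆ w)) n) _ _ ⟩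
  (D u ⋆ (v ⋆ w)) n + ((u ⋆ (D v ⋆ w)) n + (u ⋆ (v ⋆ D w)) n)
    ≡⟨ cong₂ _+_ {x = (D u ⋆ (v ⋆ w)) n} refl (sym (⋆-distribˡ u (D v ⋆ w) (v ⋆ D w) n)) ⟩
  (D u ⋆ (v ⋆ w)) n + (u ⋆ (D v ⋆ w ⊕ v ⋆ D w)) n ∎
  where open ≡-Reasoning

D-θ : ∀ u → D (θ u) ≗ D u ⊕ θ (D u)
D-θ u n = suc-* (+ n) (u (suc n))

D-ξ : ∀ u → D (ξ u) ≗ u ⊕ ξ (D u)
D-ξ u zero    = ((∀ a → 1ℤ * a ≡ a + 0ℤ) ∋ solve-∀) (u 0)
D-ξ u (suc n) = suc-* (+ suc n) (u (suc n))

θ-⋆ : ∀ u v → θ (u ⋆ v) ≗ θ u ⋆ v ⊕ u ⋆ θ v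
θ-⋆ u v zero    = ((∀ a b → 0ℤ * (a * b) ≡ 0ℤ * a * b + a * (0ℤ * b)) ∋ solve-∀) (u 0) (v 0)
θ-⋆ u v (suc n) = begin
  + suc n * ((D u ⋆ v) n + (u ⋆ D v) n)
    ≡⟨ suc-* (+ n) _ ⟩
  (a + b) + + n * (a + b)
    ≡⟨ cong₂ _+_ {x = (a + b)} refl (*-distribˡ-+ (+ n) a b) ⟩
  (a + b) + (+ n * a + + n * b)
    ≡⟨ cong₂ _+_ {x = (a + b)} refl (cong₂ _+_ (θ-⋆ (D u) v n) (θ-⋆ u (D v) n)) ⟩
  (a + b) + (((θ (D u) ⋆ v) n + (D u ⋆ θ v) n) + ((θ u ⋆ D v) n + (u ⋆ θ (D v)) n))
    ≡⟨ ((∀ a b c d e f → (a + b) + ((c + d) + (e + f)) ≡ ((a + c) + e) + (d + (b + f))) ∋ solve-∀)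
         a b _ _ _ _ ⟩
  ((a + (θ (D u) ⋆ v) n) + (θ u ⋆ D v) n) + ((D u ⋆ θ v) n + (b + (u ⋆ θ (D v)) n))
    ≡⟨ cong₂ _+_
         (cong (_+ (θ u ⋆ D v) n)
           (sym (trans (⋆-cong (D-θ u) (λ _ → refl) n) (⋆-distribʳ v (D u) (θ (D u)) n))))
         (cong₂ _+_ {x = (D u ⋆ θ v) n} refl
           (sym (trans (⋆-congˡ u (D-θ v) n) (⋆-distribˡ u (D v) (θ (D v)) n)))) ⟩
  ((D (θ u) ⋆ v) n + (θ u ⋆ D v) n) + ((D u ⋆ θ v) n + (u ⋆ D (θ v)) n) ∎
  where
  open ≡-Reasoning
  a = (D u ⋆ v) n
  b = (u ⋆ D v) n

ξ-⊕ : ∀ u v → ξ (u ⊕ v) ≗ ξ u ⊕ ξ v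
ξ-⊕ u v zero    = refl
ξ-⊕ u v (suc n) = *-distribˡ-+ (+ suc n) (u n) (v n)

ξ-⋆ : ∀ u v → ξ u ⋆ v ≗ ξ (u ⋆ v)
ξ-⋆ u v zero    = *-zeroˡ (v 0)
ξ-⋆ u v (suc n) = begin
  (D (ξ u) ⋆ v) n + (ξ u ⋆ D v) n
    ≡⟨ cong₂ _+_ (trans (⋆-cong (D-ξ u) (λ _ → refl) n) (⋆-distribʳ v u (ξ (D u)) n))
                 (ξ-⋆ u (D v) n) ⟩
  ((u ⋆ v) n + (ξ (D u) ⋆ v) n) + ξ (u ⋆ D v) n
    ≡⟨ cong (λ z → ((u ⋆ v) n + z) + ξ (u ⋆ D v) n) (ξ-⋆ (D u) v n) ⟩
  ((u ⋆ v) n + ξ (D u ⋆ v) n) + ξ (u ⋆ D v) n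
    ≡⟨ +-assoc ((u ⋆ v) n) _ _ ⟩
  (u ⋆ v) n + (ξ (D u ⋆ v) n + ξ (u ⋆ D v) n)
    ≡⟨ cong₂ _+_ {x = (u ⋆ v) n} refl (sym (ξ-⊕ (D u ⋆ v) (u ⋆ D v) n)) ⟩
  (u ⋆ v) n + ξ (D (u ⋆ v)) n
    ≡⟨ sym (D-ξ (u ⋆ v) n) ⟩
  ξ (u ⋆ v) (suc n) ∎
  where open ≡-Reasoning

pow : ℤ → Seq
pow x k = x ^ k

pow-⋆ : ∀ x y → pow x ⋆ pow y ≗ pow (x + y)
pow-⋆ x y zero    = refl
pow-⋆ x y (suc n) = trans
  (cong₂ _+_ (trans (⋆-·ˡ x (pow x) (pow y) n) (cong (x *_) (pow-⋆ x y n)))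
             (trans (⋆-·ʳ y (pow x) (pow y) n) (cong (y *_) (pow-⋆ x y n))))
  (sym (*-distribʳ-+ ((x + y) ^ n) x y))

-- Pascal's rule is the Leibniz rule read on coefficients. The recursive definition makes the
-- algebraic laws easy inductions; this lemma connects them with explicit binomial sums.
⋆-∑ : ∀ u v n → (u ⋆ v) n ≡ ∑< (suc n) (λ k → + (n C k) * (u k * v (n ∸ k)))
⋆-∑ u v zero    = ((∀ a → a ≡ 0ℤ + 1ℤ * a) ∋ solve-∀) (u 0 * v 0)
⋆-∑ u v (suc n) = begin
  (D u ⋆ v) n + (u ⋆ D v) n
    ≡⟨ cong₂ _+_ (⋆-∑ (D u) v n) (⋆-∑ u (D v) n) ⟩
  ∑< (suc n) up + ∑< (suc n) (λ k → + (n C k) * (u k * v (suc (n ∸ k))))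
    ≡⟨ cong₂ _+_ {x = ∑< (suc n) up} refl (∑-first n _) ⟩
  ∑< (suc n) up + (1ℤ * (u 0 * v (suc n))
    + ∑< n (λ k → + (n C suc k) * (u (suc k) * v (suc (n ∸ suc k)))))
    ≡⟨ cong (λ z → ∑< (suc n) up + (1ℤ * (u 0 * v (suc n)) + z))
         (trans (∑-cong n λ k k<n → cong (λ z → + (n C suc k) * (u (suc k) * v z))
                                         (sym (ℕ.+-∸-assoc 1 k<n)))
                (sym last≡0)) ⟩
  ∑< (suc n) up + (1ℤ * (u 0 * v (suc n)) + ∑< (suc n) side)
    ≡⟨ ((∀ a b c → a + (b + c) ≡ b + (a + c)) ∋ solve-∀) (∑< (suc n) up) (1ℤ * (u 0 * v (suc n))) (∑< (suc n) side) ⟩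
  1ℤ * (u 0 * v (suc n)) + (∑< (suc n) up + ∑< (suc n) side)
    ≡⟨ cong₂ _+_ {x = 1ℤ * (u 0 * v (suc n))} refl
         (trans (∑-+ (suc n) up side) (∑-cong (suc n) λ k _ → pascal k)) ⟩
  1ℤ * (u 0 * v (suc n)) + ∑< (suc n) (λ k → + (suc n C suc k) * (u (suc k) * v (n ∸ k)))
    ≡⟨ sym (∑-first (suc n) (λ k → + (suc n C k) * (u k * v (suc n ∸ k)))) ⟩
  ∑< (suc (suc n)) (λ k → + (suc n C k) * (u k * v (suc n ∸ k))) ∎
  where
  open ≡-Reasoning
  up side : ℕ → ℤ
  up k   = + (n C k) * (u (suc k) * v (n ∸ k))
  side k = + (n C suc k) * (u (suc k) * v (n ∸ k))
  -- C(n, n + 1) = 0 allows one more term, which aligns the range of `side` with that of `up`.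
  last≡0 : ∑< (suc n) side ≡ ∑< n side
  last≡0 rewrite k>n⇒nCk≡0 (ℕ.n<1+n n) =
    ((∀ a b → a + 0ℤ * b ≡ a) ∋ solve-∀) (∑< n side) (u (suc n) * v (n ∸ n))
  pascal : ∀ k → up k + side k ≡ + (suc n C suc k) * (u (suc k) * v (n ∸ k))
  pascal k = trans (sym (*-distribʳ-+ (u (suc k) * v (n ∸ k)) (+ (n C k)) (+ (n C suc k))))
    (cong (λ z → + z * (u (suc k) * v (n ∸ k))) (nCk+nC[k+1]≡[n+1]C[k+1] n k))

-- Central binomial coefficients and the recurrence

fact : Seq
fact n = + (n !)

fact-suc : ∀ n → fact (suc n) ≡ + suc n * fact n
fact-suc n = pos-* (suc n) (n !)

fact*fact≢0 : ∀ r m → ℤ.NonZero (fact r * fact m)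
fact*fact≢0 r m = i*j≢0 (fact r) (fact m) {{r ℕ.!≢0}} {{m ℕ.!≢0}}

-- The row is written as r + m, here and below, so that the complementary index is a variable and
-- not a truncated difference.
C-fact : ∀ r m → + ((r ℕ.+ m) C r) * (fact r * fact m) ≡ fact (r ℕ.+ m)
C-fact r m = begin
  + ((r ℕ.+ m) C r) * (fact r * fact m)      ≡⟨ cong (+ ((r ℕ.+ m) C r) *_) (pos-* (r !) (m !)) ⟨
  + ((r ℕ.+ m) C r) * + (r ! ℕ.* m !)        ≡⟨ pos-* ((r ℕ.+ m) C r) (r ! ℕ.* m !) ⟨
  + (((r ℕ.+ m) C r) ℕ.* (r ! ℕ.* m !))
    ≡⟨ cong (λ z → + (((r ℕ.+ m) C r) ℕ.* (r ! ℕ.* z !))) (ℕ.m+n∸m≡n r m) ⟨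
  + (((r ℕ.+ m) C r) ℕ.* (r ! ℕ.* (r ℕ.+ m ∸ r) !))
    ≡⟨ cong (λ z → + (z ℕ.* (r ! ℕ.* (r ℕ.+ m ∸ r) !))) (nCk≡n!/k![n-k]! r≤r+m) ⟩
  + ((r ℕ.+ m) ! ℕ./ (r ! ℕ.* (r ℕ.+ m ∸ r) !) ℕ.* (r ! ℕ.* (r ℕ.+ m ∸ r) !))
    ≡⟨ cong +_ (ℕ.m/n*n≡m (k![n∸k]!∣n! r≤r+m)) ⟩
  fact (r ℕ.+ m)                             ∎
  where
  open ≡-Reasoning
  instance _ = r ℕ.!* (r ℕ.+ m ∸ r) !≢0
  r≤r+m = ℕ.m≤m+n r m

C-absorb : ∀ r m → + suc r * + (suc (r ℕ.+ m) C suc r) ≡ + suc (r ℕ.+ m) * + ((r ℕ.+ m) C r)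
C-absorb r m = *-cancelʳ-≡ _ _ (fact r * fact m) {{fact*fact≢0 r m}} (begin
  + suc r * + (suc (r ℕ.+ m) C suc r) * (fact r * fact m)
    ≡⟨ ((∀ a b c d → a * b * (c * d) ≡ b * (a * c * d)) ∋ solve-∀)
         (+ suc r) (+ (suc (r ℕ.+ m) C suc r)) (fact r) (fact m) ⟩
  + (suc (r ℕ.+ m) C suc r) * (+ suc r * fact r * fact m)
    ≡⟨ cong (λ z → + (suc (r ℕ.+ m) C suc r) * (z * fact m)) (fact-suc r) ⟨
  + (suc (r ℕ.+ m) C suc r) * (fact (suc r) * fact m)
    ≡⟨ C-fact (suc r) m ⟩
  fact (suc (r ℕ.+ m))
    ≡⟨ fact-suc (r ℕ.+ m) ⟩
  + suc (r ℕ.+ m) * fact (r ℕ.+ m)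
    ≡⟨ cong (+ suc (r ℕ.+ m) *_) (C-fact r m) ⟨
  + suc (r ℕ.+ m) * (+ ((r ℕ.+ m) C r) * (fact r * fact m))
    ≡⟨ *-assoc (+ suc (r ℕ.+ m)) (+ ((r ℕ.+ m) C r)) (fact r * fact m) ⟨
  + suc (r ℕ.+ m) * + ((r ℕ.+ m) C r) * (fact r * fact m) ∎)
  where open ≡-Reasoning

C-sym : ∀ r m → (r ℕ.+ m) C r ≡ (m ℕ.+ r) C m
C-sym r m = +-injective (*-cancelʳ-≡ _ _ (fact r * fact m) {{fact*fact≢0 r m}}
  (trans (C-fact r m) (trans (cong fact (ℕ.+-comm r m))
    (trans (sym (C-fact m r)) (cong (+ ((m ℕ.+ r) C m) *_) (*-comm (fact m) (fact r)))))))

C-absorbʳ : ∀ r m → + suc m * + (suc (r ℕ.+ m) C r) ≡ + suc (r ℕ.+ m) * + ((r ℕ.+ m) C r)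
C-absorbʳ r m = begin
  + suc m * + (suc (r ℕ.+ m) C r)       ≡⟨ cong (λ z → + suc m * + (z C r)) (ℕ.+-suc r m) ⟨
  + suc m * + ((r ℕ.+ suc m) C r)       ≡⟨ cong (λ z → + suc m * + z) (C-sym r (suc m)) ⟩
  + suc m * + (suc (m ℕ.+ r) C suc m)   ≡⟨ C-absorb m r ⟩
  + suc (m ℕ.+ r) * + ((m ℕ.+ r) C m)   ≡⟨ cong₂ (λ y z → + suc y * + z) (ℕ.+-comm m r) (C-sym m r) ⟩
  + suc (r ℕ.+ m) * + ((r ℕ.+ m) C r)   ∎
  where open ≡-Reasoning

b : Seq
b k = + ((k ℕ.+ k) C k)

b-suc : ∀ k → + suc k * b (suc k) ≡ + 2 * (+ 2 * + k + 1ℤ) * b k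
b-suc k = *-cancelˡ-≡ ((1ℤ + + k) * (fact k * fact k)) _ _ {{nz}} (begin
  (1ℤ + + k) * (fact k * fact k) * (+ suc k * b (suc k))
    ≡⟨ ((∀ K f B → (1ℤ + K) * (f * f) * ((1ℤ + K) * B) ≡ B * (((1ℤ + K) * f) * ((1ℤ + K) * f))) ∋ solve-∀)
         (+ k) (fact k) (b (suc k)) ⟩
  b (suc k) * (+ suc k * fact k * (+ suc k * fact k))
    ≡⟨ cong (λ z → b (suc k) * (z * z)) (fact-suc k) ⟨
  b (suc k) * (fact (suc k) * fact (suc k))
    ≡⟨ C-fact (suc k) (suc k) ⟩
  fact (suc (k ℕ.+ suc k))
    ≡⟨ cong (fact ∘ suc) (ℕ.+-suc k k) ⟩
  fact (suc (suc (k ℕ.+ k)))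
    ≡⟨ trans (fact-suc (suc (k ℕ.+ k))) (cong (+ suc (suc (k ℕ.+ k)) *_) (fact-suc (k ℕ.+ k))) ⟩
  + suc (suc (k ℕ.+ k)) * (+ suc (k ℕ.+ k) * fact (k ℕ.+ k))
    ≡⟨ cong (λ z → + suc (suc (k ℕ.+ k)) * (+ suc (k ℕ.+ k) * z)) (C-fact k k) ⟨
  (+ 2 + (+ k + + k)) * ((1ℤ + (+ k + + k)) * (b k * (fact k * fact k)))
    ≡⟨ ((∀ K f B → (+ 2 + (K + K)) * ((1ℤ + (K + K)) * (B * (f * f)))
                 ≡ (1ℤ + K) * (f * f) * (+ 2 * (+ 2 * K + 1ℤ) * B)) ∋ solve-∀)
         (+ k) (fact k) (b k) ⟩
  (1ℤ + + k) * (fact k * fact k) * (+ 2 * (+ 2 * + k + 1ℤ) * b k) ∎)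
  where
  open ≡-Reasoning
  nz : ℤ.NonZero ((1ℤ + + k) * (fact k * fact k))
  nz = i*j≢0 (1ℤ + + k) (fact k * fact k) {{_}} {{fact*fact≢0 k k}}

-- This is `b-suc` as a differential equation: (x B′)′ = 4 x B′ + 2 B for the exponential generating
-- function B of `b`.
Dθb : D (θ b) ≗ + 4 · θ b ⊕ + 2 · b
Dθb k = trans (b-suc k)
  (((∀ K B → + 2 * (+ 2 * K + 1ℤ) * B ≡ + 4 * (K * B) + + 2 * B) ∋ solve-∀) (+ k) (b k))

-- ∑ C(n, r) r (n - r) b(r) b(n - r): an auxiliary quantity that ties consecutive values of b ⋆ b
-- together, and later a part of the Jacobsthal error.
Q : Seq
Q = θ b ⋆ θ b

θ≗ξD : ∀ u → θ u ≗ ξ (D u)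
θ≗ξD u zero    = *-zeroˡ (u 0)
θ≗ξD u (suc n) = refl

b⋆θb : ∀ n → + 2 * (b ⋆ θ b) n ≡ + n * (b ⋆ b) n
b⋆θb n = begin
  + 2 * (b ⋆ θ b) n               ≡⟨ ((∀ a → + 2 * a ≡ a + a) ∋ solve-∀) ((b ⋆ θ b) n) ⟩
  (b ⋆ θ b) n + (b ⋆ θ b) n       ≡⟨ cong (_+ (b ⋆ θ b) n) (⋆-comm b (θ b) n) ⟩
  (θ b ⋆ b) n + (b ⋆ θ b) n       ≡⟨ θ-⋆ b b n ⟨
  + n * (b ⋆ b) n                 ∎
  where open ≡-Reasoning

⋆-Dθb : ∀ u → u ⋆ D (θ b) ≗ + 4 · (u ⋆ θ b) ⊕ + 2 · (u ⋆ b)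
⋆-Dθb u n = trans (⋆-congˡ u Dθb n) (trans (⋆-distribˡ u (+ 4 · θ b) (+ 2 · b) n)
  (cong₂ _+_ (⋆-·ʳ (+ 4) u (θ b) n) (⋆-·ʳ (+ 2) u b n)))

b⋆Dθb : ∀ n → (b ⋆ D (θ b)) n ≡ + 2 * + suc n * (b ⋆ b) n
b⋆Dθb n = begin
  (b ⋆ D (θ b)) n                             ≡⟨ ⋆-Dθb b n ⟩
  + 4 * (b ⋆ θ b) n + + 2 * (b ⋆ b) n
    ≡⟨ ((∀ a s → + 4 * a + + 2 * s ≡ + 2 * (+ 2 * a) + + 2 * s) ∋ solve-∀) ((b ⋆ θ b) n) ((b ⋆ b) n) ⟩
  + 2 * (+ 2 * (b ⋆ θ b) n) + + 2 * (b ⋆ b) n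
    ≡⟨ cong (λ z → + 2 * z + + 2 * (b ⋆ b) n) (b⋆θb n) ⟩
  + 2 * (+ n * (b ⋆ b) n) + + 2 * (b ⋆ b) n
    ≡⟨ ((∀ n s → + 2 * (n * s) + + 2 * s ≡ + 2 * (1ℤ + n) * s) ∋ solve-∀) (+ n) ((b ⋆ b) n) ⟩
  + 2 * + suc n * (b ⋆ b) n ∎
  where open ≡-Reasoning

-- Apply θ to b ⋆ θ b. The Leibniz rule gives Q plus b ⋆ θ (θ b), and θ = ξ D reduces the latter to
-- b ⋆ D (θ b), known from the differential equation.
2Q : ∀ n → + 2 * Q (suc n) ≡ + suc n * + suc n * ((b ⋆ b) (suc n) - + 4 * (b ⋆ b) n)
2Q n = begin
  + 2 * Q (suc n)
    ≡⟨ ((∀ q x → + 2 * q ≡ + 2 * (q + x) - + 2 * x) ∋ solve-∀) (Q (suc n)) ((b ⋆ θ (θ b)) (suc n)) ⟩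
  + 2 * (Q (suc n) + (b ⋆ θ (θ b)) (suc n)) - + 2 * (b ⋆ θ (θ b)) (suc n)
    ≡⟨ cong₂ (λ y z → + 2 * y - + 2 * z) (sym (θ-⋆ b (θ b) (suc n))) bθθb ⟩
  + 2 * (+ suc n * (b ⋆ θ b) (suc n)) - + 2 * (+ suc n * (+ 2 * + suc n * (b ⋆ b) n))
    ≡⟨ ((∀ n x y → + 2 * (n * x) - + 2 * (n * (+ 2 * n * y)) ≡ n * (+ 2 * x) - n * n * (+ 4 * y)) ∋ solve-∀)
         (+ suc n) ((b ⋆ θ b) (suc n)) ((b ⋆ b) n) ⟩
  + suc n * (+ 2 * (b ⋆ θ b) (suc n)) - + suc n * + suc n * (+ 4 * (b ⋆ b) n)
    ≡⟨ cong (λ z → + suc n * z - + suc n * + suc n * (+ 4 * (b ⋆ b) n)) (b⋆θb (suc n)) ⟩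
  + suc n * (+ suc n * (b ⋆ b) (suc n)) - + suc n * + suc n * (+ 4 * (b ⋆ b) n)
    ≡⟨ ((∀ n x y → n * (n * x) - n * n * y ≡ n * n * (x - y)) ∋ solve-∀)
         (+ suc n) ((b ⋆ b) (suc n)) (+ 4 * (b ⋆ b) n) ⟩
  + suc n * + suc n * ((b ⋆ b) (suc n) - + 4 * (b ⋆ b) n) ∎
  where
  open ≡-Reasoning
  bθθb : (b ⋆ θ (θ b)) (suc n) ≡ + suc n * (+ 2 * + suc n * (b ⋆ b) n)
  bθθb = begin
    (b ⋆ θ (θ b)) (suc n)           ≡⟨ ⋆-congˡ b (θ≗ξD (θ b)) (suc n) ⟩
    (b ⋆ ξ (D (θ b))) (suc n)       ≡⟨ ⋆-comm b (ξ (D (θ b))) (suc n) ⟩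
    (ξ (D (θ b)) ⋆ b) (suc n)       ≡⟨ ξ-⋆ (D (θ b)) b (suc n) ⟩
    + suc n * (D (θ b) ⋆ b) n       ≡⟨ cong (+ suc n *_) (trans (⋆-comm (D (θ b)) b n) (b⋆Dθb n)) ⟩
    + suc n * (+ 2 * + suc n * (b ⋆ b) n) ∎

Q-suc : ∀ n → Q (suc n) ≡ + 8 * Q n + + 2 * (+ n * (b ⋆ b) n)
Q-suc n = begin
  (D (θ b) ⋆ θ b) n + (θ b ⋆ D (θ b)) n
    ≡⟨ cong (_+ (θ b ⋆ D (θ b)) n) (⋆-comm (D (θ b)) (θ b) n) ⟩
  (θ b ⋆ D (θ b)) n + (θ b ⋆ D (θ b)) n
    ≡⟨ cong₂ _+_ eq eq ⟩
  (+ 4 * Q n + + 2 * (b ⋆ θ b) n) + (+ 4 * Q n + + 2 * (b ⋆ θ b) n)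
    ≡⟨ cong (λ z → (+ 4 * Q n + z) + (+ 4 * Q n + z)) (b⋆θb n) ⟩
  (+ 4 * Q n + + n * (b ⋆ b) n) + (+ 4 * Q n + + n * (b ⋆ b) n)
    ≡⟨ ((∀ q x → (+ 4 * q + x) + (+ 4 * q + x) ≡ + 8 * q + + 2 * x) ∋ solve-∀) (Q n) (+ n * (b ⋆ b) n) ⟩
  + 8 * Q n + + 2 * (+ n * (b ⋆ b) n) ∎
  where
  open ≡-Reasoning
  eq : (θ b ⋆ D (θ b)) n ≡ + 4 * Q n + + 2 * (b ⋆ θ b) n
  eq = trans (⋆-Dθb (θ b) n) (cong (λ z → + 4 * Q n + + 2 * z) (⋆-comm (θ b) b n))

RecurrenceAt : Seq → ℕ → Set
RecurrenceAt S n = + suc (suc n) * + suc (suc n) * S (suc (suc n))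
  ≡ + 4 * (+ 3 * (+ suc n * + suc n) + + 3 * + suc n + 1ℤ) * S (suc n)
    - + 32 * (+ suc n * + suc n) * S n

-- Q is eliminated: `2Q` expresses two consecutive values of Q through b ⋆ b, and `Q-suc` relates
-- these values to each other.
b⋆b-recurrence : ∀ n → RecurrenceAt (b ⋆ b) n
b⋆b-recurrence n = begin
  N′ * N′ * S (suc (suc n))
    ≡⟨ ((∀ a x y → a * a * x ≡ a * a * (x - + 4 * y) + a * a * (+ 4 * y)) ∋ solve-∀)
         N′ (S (suc (suc n))) (S (suc n)) ⟩
  N′ * N′ * (S (suc (suc n)) - + 4 * S (suc n)) + N′ * N′ * (+ 4 * S (suc n))
    ≡⟨ cong (_+ N′ * N′ * (+ 4 * S (suc n))) (sym (2Q (suc n))) ⟩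
  + 2 * Q (suc (suc n)) + N′ * N′ * (+ 4 * S (suc n))
    ≡⟨ cong (λ z → + 2 * z + N′ * N′ * (+ 4 * S (suc n))) (Q-suc (suc n)) ⟩
  + 2 * (+ 8 * Q (suc n) + + 2 * (N * S (suc n))) + N′ * N′ * (+ 4 * S (suc n))
    ≡⟨ ((∀ q x y → + 2 * (+ 8 * q + + 2 * x) + y ≡ + 8 * (+ 2 * q) + + 4 * x + y) ∋ solve-∀)
         (Q (suc n)) (N * S (suc n)) (N′ * N′ * (+ 4 * S (suc n))) ⟩
  + 8 * (+ 2 * Q (suc n)) + + 4 * (N * S (suc n)) + N′ * N′ * (+ 4 * S (suc n))
    ≡⟨ cong (λ z → + 8 * z + + 4 * (N * S (suc n)) + N′ * N′ * (+ 4 * S (suc n))) (2Q n) ⟩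
  + 8 * (N * N * (S (suc n) - + 4 * S n)) + + 4 * (N * S (suc n)) + N′ * N′ * (+ 4 * S (suc n))
    ≡⟨ ((∀ N x y → + 8 * (N * N * (x - + 4 * y)) + + 4 * (N * x) + (1ℤ + N) * (1ℤ + N) * (+ 4 * x)
             ≡ + 4 * (+ 3 * (N * N) + + 3 * N + 1ℤ) * x - + 32 * (N * N) * y) ∋ solve-∀)
         N (S (suc n)) (S n) ⟩
  + 4 * (+ 3 * (N * N) + + 3 * N + 1ℤ) * S (suc n) - + 32 * (N * N) * S n ∎
  where
  open ≡-Reasoning
  N N′ : ℤ
  N  = + suc n
  N′ = + suc (suc n)
  S : Seq
  S  = b ⋆ b

pos-^2 : ∀ n → + (n ℕ.^ 2) ≡ + n * + n
pos-^2 n = trans (pos-* n (n ℕ.* 1)) (cong (λ z → + n * + z) (ℕ.*-identityʳ n))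

IsAperyLikeS⇒recurrence : ∀ {S} → IsAperyLikeS S → ∀ n → RecurrenceAt S n
IsAperyLikeS⇒recurrence {S} isS n = begin
  + suc (suc n) * + suc (suc n) * S (suc (suc n))
    ≡⟨ cong (_* S (suc (suc n))) (sym (pos-^2 (suc (suc n)))) ⟩
  + (suc (suc n) ℕ.^ 2) * S (suc (suc n))
    ≡⟨ IsAperyLikeS.Sₙ₊₁ isS (suc n) ⟩
  + (4 ℕ.* (3 ℕ.* suc n ℕ.^ 2 ℕ.+ 3 ℕ.* suc n ℕ.+ 1)) * S (suc n) - + (32 ℕ.* suc n ℕ.^ 2) * S n
    ≡⟨ cong₂ (λ y z → y * S (suc n) - z * S n) c₁ c₂ ⟩
  + 4 * (+ 3 * (+ suc n * + suc n) + + 3 * + suc n + 1ℤ) * S (suc n)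
    - + 32 * (+ suc n * + suc n) * S n ∎
  where
  open ≡-Reasoning
  c₁ : + (4 ℕ.* (3 ℕ.* suc n ℕ.^ 2 ℕ.+ 3 ℕ.* suc n ℕ.+ 1))
     ≡ + 4 * (+ 3 * (+ suc n * + suc n) + + 3 * + suc n + 1ℤ)
  c₁ = trans (pos-* 4 (3 ℕ.* suc n ℕ.^ 2 ℕ.+ 3 ℕ.* suc n ℕ.+ 1))
    (cong₂ (λ y z → + 4 * (y + z + 1ℤ))
      (trans (pos-* 3 (suc n ℕ.^ 2)) (cong (+ 3 *_) (pos-^2 (suc n)))) (pos-* 3 (suc n)))
  c₂ : + (32 ℕ.* suc n ℕ.^ 2) ≡ + 32 * (+ suc n * + suc n)
  c₂ = trans (pos-* 32 (suc n ℕ.^ 2)) (cong (+ 32 *_) (pos-^2 (suc n)))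

recurrence-unique : ∀ {S T} → S 0 ≡ T 0 → S 1 ≡ T 1 →
  (∀ n → RecurrenceAt S n) → (∀ n → RecurrenceAt T n) → S ≗ T
recurrence-unique {S} {T} eq₀ eq₁ recS recT n = proj₁ (go n)
  where
  go : ∀ n → S n ≡ T n × S (suc n) ≡ T (suc n)
  go zero    = eq₀ , eq₁
  go (suc n) with go n
  ... | eqₙ , eqₙ₊₁ = eqₙ₊₁ ,
    *-cancelˡ-≡ (+ suc (suc n) * + suc (suc n)) _ _ {{i*j≢0 (+ suc (suc n)) (+ suc (suc n))}} (trans (recS n)
      (trans (cong₂ (λ y z → + 4 * (+ 3 * (+ suc n * + suc n) + + 3 * + suc n + 1ℤ) * y
                             - + 32 * (+ suc n * + suc n) * z) eqₙ₊₁ eqₙ)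
             (sym (recT n))))

IsAperyLikeS⇒b⋆b : ∀ {S} → IsAperyLikeS S → S ≗ b ⋆ b
IsAperyLikeS⇒b⋆b isS = recurrence-unique (IsAperyLikeS.S₀ isS) (IsAperyLikeS.S₁ isS)
  (IsAperyLikeS⇒recurrence isS) b⋆b-recurrence

-- Congruences

infix 4 _≅_[_]

-- A record, so that unification can read off both sides of a congruence, which it could not recover
-- from the difference `a - b`.
record _≅_[_] (a b M : ℤ) : Set where
  constructor mod
  field div : M ∣ℤ a - b

open _≅_[_] public

∣-resp : ∀ {M a b} → a ≡ b → M ∣ℤ a → M ∣ℤ b
∣-resp refl M∣a = M∣a

≅-from : ∀ {M a b c} → c ≡ a - b → M ∣ℤ c → a ≅ b [ M ]
≅-from eq M∣c = mod (∣-resp eq M∣c)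

≅-reflexive : ∀ {M a b} → a ≡ b → a ≅ b [ M ]
≅-reflexive {M} {a} refl = ≅-from (sym (+-inverseʳ a)) (divides 0ℤ refl)

≅-refl : ∀ {M a} → a ≅ a [ M ]
≅-refl = ≅-reflexive refl

≅-sym : ∀ {M a b} → a ≅ b [ M ] → b ≅ a [ M ]
≅-sym {M} {a} {b} (mod d) = ≅-from (((∀ a b → - (a - b) ≡ b - a) ∋ solve-∀) a b) (∣m⇒∣-m d)

≅-trans : ∀ {M a b c} → a ≅ b [ M ] → b ≅ c [ M ] → a ≅ c [ M ]
≅-trans {M} {a} {b} {c} (mod d) (mod e) =
  ≅-from (((∀ a b c → (a - b) + (b - c) ≡ a - c) ∋ solve-∀) a b c) (∣m∣n⇒∣m+n d e)

≅-setoid : ℤ → Setoid _ _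
≅-setoid M = record
  { Carrier = ℤ ; _≈_ = _≅_[ M ]
  ; isEquivalence = record { refl = ≅-refl ; sym = ≅-sym ; trans = ≅-trans } }

module ≅-Reasoning (M : ℤ) where
  open import Relation.Binary.Reasoning.Setoid (≅-setoid M) public

+-≅ : ∀ {M a b c d} → a ≅ b [ M ] → c ≅ d [ M ] → a + c ≅ b + d [ M ]
+-≅ {M} {a} {b} {c} {d} (mod x) (mod y) =
  ≅-from (((∀ a b c d → (a - b) + (c - d) ≡ (a + c) - (b + d)) ∋ solve-∀) a b c d)
    (∣m∣n⇒∣m+n x y)

*-≅ : ∀ {M a b c d} → a ≅ b [ M ] → c ≅ d [ M ] → a * c ≅ b * d [ M ]
*-≅ {M} {a} {b} {c} {d} (mod x) (mod y) =
  ≅-from (((∀ a b c d → (a - b) * c + b * (c - d) ≡ a * c - b * d) ∋ solve-∀) a b c d)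
    (∣m∣n⇒∣m+n (∣m⇒∣m*n c x) (∣n⇒∣m*n b y))

*-≅ˡ : ∀ {M} a {b c} → b ≅ c [ M ] → a * b ≅ a * c [ M ]
*-≅ˡ a = *-≅ (≅-refl {a = a})

neg-≅ : ∀ {M a b} → a ≅ b [ M ] → - a ≅ - b [ M ]
neg-≅ {M} {a} {b} (mod x) =
  ≅-from (((∀ a b → - (a - b) ≡ - a - - b) ∋ solve-∀) a b) (∣m⇒∣-m x)

^-≅ : ∀ {M a b} n → a ≅ b [ M ] → a ^ n ≅ b ^ n [ M ]
^-≅ zero    x = ≅-refl
^-≅ (suc n) x = *-≅ x (^-≅ n x)

∑-≅ : ∀ {M} n {f g} → (∀ i → i ℕ.< n → f i ≅ g i [ M ]) → ∑< n f ≅ ∑< n g [ M ]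
∑-≅ zero    eq = ≅-refl
∑-≅ (suc n) eq =
  +-≅ (∑-≅ n λ i i<n → eq i (ℕ.m<n⇒m<1+n i<n)) (eq n (ℕ.n<1+n n))

≅0 : ∀ {M a} → M ∣ℤ a → a ≅ 0ℤ [ M ]
≅0 {a = a} = ≅-from (((∀ a → a ≡ a - 0ℤ) ∋ solve-∀) a)

≅-∣ : ∀ {M a b} → a ≅ b [ M ] → M ∣ℤ b → M ∣ℤ a
≅-∣ {M} {a} {b} (mod d) e = ∣-resp (((∀ a b → (a - b) + b ≡ a) ∋ solve-∀) a b) (∣m∣n⇒∣m+n d e)

≅-weaken : ∀ {M N a b} → N ∣ℤ M → a ≅ b [ M ] → a ≅ b [ N ]
≅-weaken d (mod e) = mod (∣-trans d e)

∣-multiple : ∀ {M} a → M ∣ℤ a * M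
∣-multiple a = divides a refl

+-multiple-≅ : ∀ {M} a k → a + k * M ≅ a [ M ]
+-multiple-≅ {M} a k = ≅-from (((∀ a k M → k * M ≡ (a + k * M) - a) ∋ solve-∀) a k M) (∣-multiple k)

-- Tools on factorials, divisibility of binomials, powers and parity

fact-+ : ∀ m k → fact (m ℕ.+ k) ≡ fact m * ∏< k (λ i → + suc (m ℕ.+ i))
fact-+ m zero    = trans (cong fact (ℕ.+-identityʳ m)) (sym (*-identityʳ (fact m)))
fact-+ m (suc k) = begin
  fact (m ℕ.+ suc k)                   ≡⟨ cong fact (ℕ.+-suc m k) ⟩
  fact (suc (m ℕ.+ k))                 ≡⟨ fact-suc (m ℕ.+ k) ⟩
  + suc (m ℕ.+ k) * fact (m ℕ.+ k)     ≡⟨ cong (+ suc (m ℕ.+ k) *_) (fact-+ m k) ⟩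
  + suc (m ℕ.+ k) * (fact m * Π)       ≡⟨ ((∀ a b c → a * (b * c) ≡ b * (c * a)) ∋ solve-∀) (+ suc (m ℕ.+ k)) (fact m) Π ⟩
  fact m * (Π * + suc (m ℕ.+ k))       ∎
  where
  open ≡-Reasoning
  Π : ℤ
  Π = ∏< k (λ i → + suc (m ℕ.+ i))

C-step : ∀ k o → + suc k * + (suc (k ℕ.+ o) C suc k) ≡ + suc o * + (suc (k ℕ.+ o) C k)
C-step k o = trans (C-absorb k o) (sym (C-absorbʳ k o))

-- Absorption: C(n, r) r = n C(n - 1, r - 1). A modulus dividing n thus divides the weighted index
-- even when it does not divide r.
∣-absorb : ∀ r m → + (r ℕ.+ m) ∣ℤ + ((r ℕ.+ m) C r) * + r
∣-absorb zero    m = divides 0ℤ (*-zeroʳ (+ (m C 0)))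
∣-absorb (suc r) m = divides (+ ((r ℕ.+ m) C r))
  (trans (*-comm (+ (suc (r ℕ.+ m) C suc r)) (+ suc r))
    (trans (C-absorb r m) (*-comm (+ suc (r ℕ.+ m)) (+ ((r ℕ.+ m) C r)))))

∣-absorbʳ : ∀ r m → + (r ℕ.+ m) ∣ℤ + ((r ℕ.+ m) C r) * + m
∣-absorbʳ r m = subst₂ _∣ℤ_ (cong +_ (ℕ.+-comm m r)) (cong (λ z → + z * + m) (C-sym m r)) (∣-absorb m r)

-- The way moduli grow: next to a cofactor that vanishes modulo N, the other factor may be replaced
-- on the strength of a congruence modulo M alone.
*-≅-∣ : ∀ {M N a b c} → a ≅ b [ M ] → N ∣ℤ c → a * c ≅ b * c [ M * N ]
*-≅-∣ {M} {N} {a} {b} (mod (divides j eq)) (divides k refl) = mod (divides (j * k)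
  (trans (((∀ a b c → a * c - b * c ≡ (a - b) * c) ∋ solve-∀) a b (k * N))
    (trans (cong (_* (k * N)) eq) (((∀ j M k N → j * M * (k * N) ≡ j * k * (M * N)) ∋ solve-∀) j M k N))))

∑-pairs : ∀ n f → ∑< (n ℕ.+ n) f ≡ ∑< n (λ i → f (i ℕ.+ i) + f (suc (i ℕ.+ i)))
∑-pairs zero    f = refl
∑-pairs (suc n) f = begin
  ∑< (n ℕ.+ suc n) f + f (n ℕ.+ suc n)          ≡⟨ cong (λ z → ∑< z f + f z) (ℕ.+-suc n n) ⟩
  ∑< (n ℕ.+ n) f + f (n ℕ.+ n) + f (suc (n ℕ.+ n))
    ≡⟨ +-assoc (∑< (n ℕ.+ n) f) (f (n ℕ.+ n)) (f (suc (n ℕ.+ n))) ⟩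
  ∑< (n ℕ.+ n) f + (f (n ℕ.+ n) + f (suc (n ℕ.+ n)))
    ≡⟨ cong (_+ (f (n ℕ.+ n) + f (suc (n ℕ.+ n)))) (∑-pairs n f) ⟩
  ∑< (suc n) (λ i → f (i ℕ.+ i) + f (suc (i ℕ.+ i))) ∎
  where open ≡-Reasoning

sum-toℕ : ∀ n f → sum +-0-monoid {n} (f ∘ toℕ) ≡ ∑< n f
sum-toℕ zero    f = refl
sum-toℕ (suc n) f = trans (cong (λ z → f 0 + z) (sum-toℕ n (f ∘ suc))) (sym (∑-first n f))

*-^ : ∀ x y n → (x * y) ^ n ≡ x ^ n * y ^ n
*-^ x y zero    = refl
*-^ x y (suc n) = trans (cong (x * y *_) (*-^ x y n))
  (((∀ x y a b → x * y * (a * b) ≡ x * a * (y * b)) ∋ solve-∀) x y (x ^ n) (y ^ n))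

^-double : ∀ x n → x ^ (n ℕ.+ n) ≡ (x * x) ^ n
^-double x n = trans (^-distribˡ-+-* x n n) (sym (*-^ x x n))

neg-^-double : ∀ x n → (- x) ^ (n ℕ.+ n) ≡ x ^ (n ℕ.+ n)
neg-^-double x n = trans (^-double (- x) n)
  (trans (cong (_^ n) (((∀ x → - x * - x ≡ x * x) ∋ solve-∀) x)) (sym (^-double x n)))

even⊎odd : ∀ n → (∃[ k ] n ≡ k ℕ.+ k) ⊎ (∃[ k ] n ≡ suc (k ℕ.+ k))
even⊎odd zero    = inj₁ (0 , refl)
even⊎odd (suc n) with even⊎odd n
... | inj₁ (k , refl) = inj₂ (k , refl)
... | inj₂ (k , refl) = inj₁ (suc k , cong suc (sym (ℕ.+-suc k k)))

⋆-identityʳ : ∀ u → u ⋆ pow 0ℤ ≗ u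
⋆-identityʳ u zero    = *-identityʳ (u 0)
⋆-identityʳ u (suc n) = begin
  (D u ⋆ pow 0ℤ) n + (u ⋆ (0ℤ · pow 0ℤ)) n   ≡⟨ cong₂ _+_ (⋆-identityʳ (D u) n) (⋆-·ʳ 0ℤ u (pow 0ℤ) n) ⟩
  u (suc n) + 0ℤ * (u ⋆ pow 0ℤ) n          ≡⟨ ((∀ a b → a + 0ℤ * b ≡ a) ∋ solve-∀) (u (suc n)) ((u ⋆ pow 0ℤ) n) ⟩
  u (suc n)                                ∎
  where open ≡-Reasoning

-- Euler numbers

-- The substitution x ↦ -x in the generating function, needed to express that sech is even.
twist : Seq → Seq
twist u n = -1ℤ ^ n * u n

D-twist : ∀ u → D (twist u) ≗ -1ℤ · twist (D u)
D-twist u n = *-assoc -1ℤ (-1ℤ ^ n) (u (suc n))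

twist-⋆ : ∀ u v → twist (u ⋆ v) ≗ twist u ⋆ twist v
twist-⋆ u v zero    = ((∀ a b → 1ℤ * (a * b) ≡ 1ℤ * a * (1ℤ * b)) ∋ solve-∀) (u 0) (v 0)
twist-⋆ u v (suc n) = begin
  -1ℤ * -1ℤ ^ n * ((D u ⋆ v) n + (u ⋆ D v) n)
    ≡⟨ ((∀ e a b → -1ℤ * e * (a + b) ≡ -1ℤ * (e * a) + -1ℤ * (e * b)) ∋ solve-∀) (-1ℤ ^ n) ((D u ⋆ v) n) ((u ⋆ D v) n) ⟩
  -1ℤ * twist (D u ⋆ v) n + -1ℤ * twist (u ⋆ D v) n
    ≡⟨ cong₂ (λ y z → -1ℤ * y + -1ℤ * z) (twist-⋆ (D u) v n) (twist-⋆ u (D v) n) ⟩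
  -1ℤ * (twist (D u) ⋆ twist v) n + -1ℤ * (twist u ⋆ twist (D v)) n
    ≡⟨ cong₂ _+_
         (trans (⋆-cong (D-twist u) (λ _ → refl) n) (⋆-·ˡ -1ℤ (twist (D u)) (twist v) n))
         (trans (⋆-congˡ (twist u) (D-twist v) n) (⋆-·ʳ -1ℤ (twist u) (twist (D v)) n)) ⟨
  (D (twist u) ⋆ twist v) n + (twist u ⋆ D (twist v)) n ∎
  where open ≡-Reasoning

-1^[n+n] : ∀ n → -1ℤ ^ (n ℕ.+ n) ≡ 1ℤ
-1^[n+n] n = trans (^-double -1ℤ n) (^-zeroˡ n)

module Euler (E : Seq) (isEuler : IsEuler E) where
  open IsEuler isEuler

  E-odd : ∀ k → E (suc (k ℕ.+ k)) ≡ 0ℤ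
  E-odd k = trans (cong E (trans (sym (ℕ.+-suc k k)) (cong (k ℕ.+_) (sym (ℕ.+-identityʳ (suc k)))))) (E₂ₙ₋₁ (suc k))

  -- The rescaled Euler polynomial 2ⁿ Eₙ((x + 1)/2), with generating function sech(t) e^(xt); in
  -- this scaling its coefficients are integers.
  W : ℤ → Seq
  W x = E ⋆ pow x

  2*≡ : ∀ k → 2 ℕ.* k ≡ k ℕ.+ k
  2*≡ k = cong (k ℕ.+_) (ℕ.+-identityʳ k)

  -- The defining sum of the Euler numbers, with the vanishing terms of odd index reinserted.
  W1-even : ∀ k .{{_ : NonZero k}} → W 1ℤ (k ℕ.+ k) ≡ 0ℤ
  W1-even k = begin
    W 1ℤ (k ℕ.+ k)                                           ≡⟨ ⋆-∑ E (pow 1ℤ) (k ℕ.+ k) ⟩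
    ∑< (suc (k ℕ.+ k)) (λ i → + ((k ℕ.+ k) C i) * (E i * 1ℤ ^ (k ℕ.+ k ∸ i)))
      ≡⟨ ∑-cong (suc (k ℕ.+ k)) (λ i _ → cong (+ ((k ℕ.+ k) C i) *_)
           (trans (cong (E i *_) (^-zeroˡ (k ℕ.+ k ∸ i))) (*-identityʳ (E i)))) ⟩
    ∑< (suc (k ℕ.+ k)) e                                     ≡⟨ cong (_+ e (k ℕ.+ k)) (∑-pairs k e) ⟩
    ∑< k (λ i → e (i ℕ.+ i) + e (suc (i ℕ.+ i))) + e (k ℕ.+ k)
      ≡⟨ cong (_+ e (k ℕ.+ k)) (∑-cong k λ i _ → trans
           (cong (λ z → e (i ℕ.+ i) + + ((k ℕ.+ k) C suc (i ℕ.+ i)) * z) (E-odd i))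
           (((∀ a b → a + b * 0ℤ ≡ a) ∋ solve-∀) (e (i ℕ.+ i)) (+ ((k ℕ.+ k) C suc (i ℕ.+ i))))) ⟩
    ∑< (suc k) (λ i → e (i ℕ.+ i))
      ≡⟨ ∑-cong (suc k) (λ i _ → cong₂ (λ y z → + (y C z) * E z) (sym (2*≡ k)) (sym (2*≡ i))) ⟩
    ∑< (suc k) (λ i → + ((2 ℕ.* k) C (2 ℕ.* i)) * E (2 ℕ.* i))
      ≡⟨ sum-toℕ (suc k) (λ i → + ((2 ℕ.* k) C (2 ℕ.* i)) * E (2 ℕ.* i)) ⟨
    sum +-0-monoid {suc k} (λ i → + ((2 ℕ.* k) C (2 ℕ.* toℕ i)) * E (2 ℕ.* toℕ i))
      ≡⟨ ∑E₂ₖ≡0 k ⟩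
    0ℤ ∎
    where
    open ≡-Reasoning
    e : ℕ → ℤ
    e i = + ((k ℕ.+ k) C i) * E i

  twist-E : twist E ≗ E
  twist-E n with even⊎odd n
  ... | inj₁ (k , refl) = trans (cong (_* E (k ℕ.+ k)) (-1^[n+n] k)) (*-identityˡ (E (k ℕ.+ k)))
  ... | inj₂ (k , refl) rewrite E-odd k = *-zeroʳ (-1ℤ ^ suc (k ℕ.+ k))

  W-neg1 : W -1ℤ ≗ twist (W 1ℤ)
  W-neg1 n = trans (⋆-cong (sym ∘ twist-E) twist-pow n) (sym (twist-⋆ E (pow 1ℤ) n))
    where
    twist-pow : pow -1ℤ ≗ twist (pow 1ℤ)
    twist-pow k = sym (trans (cong (-1ℤ ^ k *_) (^-zeroˡ k)) (*-identityʳ (-1ℤ ^ k)))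

  -- The generating function of E is sech.
  W1+W-1 : W 1ℤ ⊕ W -1ℤ ≗ + 2 · pow 0ℤ
  W1+W-1 n = trans (cong (λ z → W 1ℤ n + z) (W-neg1 n)) (go (even⊎odd n))
    where
    go : (∃[ k ] n ≡ k ℕ.+ k) ⊎ (∃[ k ] n ≡ suc (k ℕ.+ k)) → W 1ℤ n + twist (W 1ℤ) n ≡ + 2 * 0ℤ ^ n
    go (inj₁ (zero  , refl)) rewrite E₀ = refl
    go (inj₁ (suc k , refl)) = trans (cong (λ z → z + -1ℤ ^ (suc k ℕ.+ suc k) * z) (W1-even (suc k)))
      (((∀ e x → 0ℤ + e * 0ℤ ≡ + 2 * (0ℤ * x)) ∋ solve-∀) (-1ℤ ^ (suc k ℕ.+ suc k)) (0ℤ ^ (k ℕ.+ suc k)))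
    go (inj₂ (k     , refl)) = trans
      (cong (λ z → W 1ℤ (suc (k ℕ.+ k)) + -1ℤ * z * W 1ℤ (suc (k ℕ.+ k))) (-1^[n+n] k))
      (((∀ w x → w + -1ℤ * 1ℤ * w ≡ + 2 * (0ℤ * x)) ∋ solve-∀) (W 1ℤ (suc (k ℕ.+ k))) (0ℤ ^ (k ℕ.+ k)))

  -- Multiply (e^t + e^(-t)) sech t = 2 by e^(xt).
  W-step : ∀ x n → W (x + 1ℤ) n + W (x - 1ℤ) n ≡ + 2 * x ^ n
  W-step x n = begin
    W (x + 1ℤ) n + W (x - 1ℤ) n                          ≡⟨ cong₂ _+_ (shift 1ℤ) (shift -1ℤ) ⟩
    (W 1ℤ ⋆ pow x) n + (W -1ℤ ⋆ pow x) n                 ≡⟨ ⋆-distribʳ (pow x) (W 1ℤ) (W -1ℤ) n ⟨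
    ((W 1ℤ ⊕ W -1ℤ) ⋆ pow x) n                           ≡⟨ ⋆-cong W1+W-1 (λ _ → refl) n ⟩
    ((+ 2 · pow 0ℤ) ⋆ pow x) n                           ≡⟨ ⋆-·ˡ (+ 2) (pow 0ℤ) (pow x) n ⟩
    + 2 * (pow 0ℤ ⋆ pow x) n                             ≡⟨ cong (+ 2 *_) (trans (⋆-comm (pow 0ℤ) (pow x) n) (⋆-identityʳ (pow x) n)) ⟩
    + 2 * x ^ n                                          ∎
    where
    open ≡-Reasoning
    shift : ∀ y → W (x + y) n ≡ (W y ⋆ pow x) n
    shift y = trans (cong (λ z → W z n) (+-comm x y))
      (trans (⋆-congˡ E (sym ∘ pow-⋆ y x) n) (sym (⋆-assoc E (pow y) (pow x) n)))

  W-≅ : ∀ {M x y} n → x ≅ y [ M ] → W x n ≅ W y n [ M ]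
  W-≅ {M} {x} {y} n x≅y = ≅-trans (≅-reflexive (⋆-∑ E (pow x) n))
    (≅-trans (∑-≅ (suc n) λ k _ → *-≅ˡ (+ (n C k)) (*-≅ˡ (E k) (^-≅ (n ∸ k) x≅y)))
             (≅-reflexive (sym (⋆-∑ E (pow y) n))))

  -- `W-step` at the even points 2, 4, ..., 2m yields W at their odd neighbours. Consecutive terms
  -- share a neighbour with opposite signs, so only the two ends 1 and 2m + 1 survive.
  telescope : ∀ k m → ∑< m (λ i → -1ℤ ^ suc i * (+ 2 * (+ suc i + + suc i) ^ k))
    ≡ -1ℤ ^ m * W (+ suc (m ℕ.+ m)) k - W 1ℤ k
  telescope k zero    = ((∀ w → 0ℤ ≡ 1ℤ * w - w) ∋ solve-∀) (W 1ℤ k)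
  telescope k (suc m) = begin
    ∑< m u + -1ℤ ^ suc m * (+ 2 * x ^ k)
      ≡⟨ cong₂ (λ y z → y + -1ℤ ^ suc m * z) (telescope k m) (sym (W-step x k)) ⟩
    -1ℤ ^ m * W (+ suc (m ℕ.+ m)) k - W 1ℤ k + -1ℤ * -1ℤ ^ m * (W (x + 1ℤ) k + W (x - 1ℤ) k)
      ≡⟨ cong₂ (λ y z → -1ℤ ^ m * W (+ suc (m ℕ.+ m)) k - W 1ℤ k + -1ℤ * -1ℤ ^ m * (W y k + W z k))
           (+-comm x 1ℤ) (((∀ M → (1ℤ + M) + (1ℤ + M) - 1ℤ ≡ 1ℤ + (M + M)) ∋ solve-∀) (+ m)) ⟩
    -1ℤ ^ m * W (+ suc (m ℕ.+ m)) k - W 1ℤ k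
      + -1ℤ * -1ℤ ^ m * (W (+ suc (suc m ℕ.+ suc m)) k + W (+ suc (m ℕ.+ m)) k)
      ≡⟨ ((∀ e a b c → e * a - b + -1ℤ * e * (c + a) ≡ -1ℤ * e * c - b) ∋ solve-∀)
           (-1ℤ ^ m) (W (+ suc (m ℕ.+ m)) k) (W 1ℤ k) (W (+ suc (suc m ℕ.+ suc m)) k) ⟩
    -1ℤ ^ suc m * W (+ suc (suc m ℕ.+ suc m)) k - W 1ℤ k ∎
    where
    open ≡-Reasoning
    x : ℤ
    x = + suc m + + suc m
    u : ℕ → ℤ
    u i = -1ℤ ^ suc i * (+ 2 * (+ suc i + + suc i) ^ k)

≅⇒≡mod : ∀ {a b M m} → + m ≡ M → a ≅ b [ M ] → a ≡ b [mod m ]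
≅⇒≡mod refl (mod d) = ∣⇒∣ᵤ d

pos-^ : ∀ p k → + (p ℕ.^ k) ≡ (+ p) ^ k
pos-^ p zero    = refl
pos-^ p (suc k) = trans (pos-* p (p ℕ.^ k)) (cong (+ p *_) (pos-^ p k))

oddPrime⇒3+2l : ∀ p → Prime p → 2 ∤ p → ∃[ l ] p ≡ 3 ℕ.+ (l ℕ.+ l)
oddPrime⇒3+2l p p-prime 2∤p with even⊎odd p
... | inj₁ (k , refl) = ⊥-elim (2∤p (ℕ.divides k (trans (sym (cong (k ℕ.+_) (ℕ.+-identityʳ k))) (ℕ.*-comm 2 k))))
... | inj₂ (zero , refl) = ⊥-elim (¬prime[1] p-prime)
... | inj₂ (suc l , refl) = l , cong (suc ∘ suc) (ℕ.+-suc l l)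

-- Residues modulo 3, for the case p = 3

mod3 : ∀ n → + 3 ∣ℤ + n ⊎ + 3 ∣ℤ + suc n ⊎ + 3 ∣ℤ + suc (suc n)
mod3 zero    = inj₁ (divides 0ℤ refl)
mod3 (suc n) with mod3 n
... | inj₁ d        = inj₂ (inj₂ (∣m∣n⇒∣m+n (∣-refl {+ 3}) d))
... | inj₂ (inj₁ d) = inj₁ d
... | inj₂ (inj₂ d) = inj₂ (inj₁ d)

-- For n₁ > 0 with 3 ∣ n₁, the coefficients (n₁ + 1)², 4 (3n₁² + 3n₁ + 1) and 32 n₁² of the
-- recurrence are 1, 1 and 0 modulo 3.
b⋆b-mod3 : ∀ n₁ → + 3 ∣ℤ + n₁ → (b ⋆ b) (suc n₁) ≅ (b ⋆ b) n₁ [ + 3 ]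
b⋆b-mod3 zero    _ = mod (divides 1ℤ refl)
b⋆b-mod3 (suc m) d@(divides k eq) = begin
  S (suc (suc m))
    ≈⟨ ≅-sym (+-multiple-≅ (S (suc (suc m))) ((+ 2 * k + + 3 * (k * k)) * S (suc (suc m)))) ⟩
  S (suc (suc m)) + (+ 2 * k + + 3 * (k * k)) * S (suc (suc m)) * + 3
    ≡⟨ ((∀ k s → s + (+ 2 * k + + 3 * (k * k)) * s * + 3 ≡ (1ℤ + k * + 3) * (1ℤ + k * + 3) * s) ∋ solve-∀) k (S (suc (suc m))) ⟩
  (1ℤ + k * + 3) * (1ℤ + k * + 3) * S (suc (suc m))
    ≡⟨ cong (λ z → (1ℤ + z) * (1ℤ + z) * S (suc (suc m))) eq ⟨
  + suc (suc m) * + suc (suc m) * S (suc (suc m))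
    ≡⟨ b⋆b-recurrence m ⟩
  + 4 * (+ 3 * (+ suc m * + suc m) + + 3 * + suc m + 1ℤ) * S (suc m) - + 32 * (+ suc m * + suc m) * S m
    ≡⟨ cong (λ z → + 4 * (+ 3 * (z * z) + + 3 * z + 1ℤ) * S (suc m) - + 32 * (z * z) * S m) eq ⟩
  + 4 * (+ 3 * (k * + 3 * (k * + 3)) + + 3 * (k * + 3) + 1ℤ) * S (suc m) - + 32 * (k * + 3 * (k * + 3)) * S m
    ≡⟨ ((∀ k x y → + 4 * (+ 3 * (k * + 3 * (k * + 3)) + + 3 * (k * + 3) + 1ℤ) * x - + 32 * (k * + 3 * (k * + 3)) * y
          ≡ x + (x + + 12 * (k + + 3 * (k * k)) * x - + 96 * (k * k) * y) * + 3) ∋ solve-∀) k (S (suc m)) (S m) ⟩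
  S (suc m) + (S (suc m) + + 12 * (k + + 3 * (k * k)) * S (suc m) - + 96 * (k * k) * S m) * + 3
    ≈⟨ +-multiple-≅ (S (suc m)) (S (suc m) + + 12 * (k + + 3 * (k * k)) * S (suc m) - + 96 * (k * k) * S m) ⟩
  S (suc m) ∎
  where
  open ≅-Reasoning (+ 3)
  S : Seq
  S = b ⋆ b

-- For p = 3 both κ and τ equal -1. This is the resulting correction to S(n), divided by 9, minus
-- the claimed (n - 1) S(n).
residual : (N s s₁ q : ℤ) → ℤ
residual N s s₁ q = - (N * (+ 2 * (N * N) * s - + 5 * q)) - + 4 * (N * N) * s₁ - (N - 1ℤ) * s

-- Doubling lets `2Q` remove Q. Put N = n + 1. If N ≡ 1 modulo 3 then S(N) ≡ S(N - 1) by the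
-- recurrence; if N ≡ 2 the coefficient 2 - N vanishes; N² ≡ 1 in both cases.
3∣residual : ∀ n → 3 ∤ suc n → + 3 ∣ℤ residual (+ suc n) ((b ⋆ b) (suc n)) ((b ⋆ b) n) (Q (suc n))
3∣residual n 3∤n = go (+ suc n) ((b ⋆ b) (suc n)) ((b ⋆ b) n) (Q (suc n)) (2Q n) (proj₁ 3∣both) (proj₂ 3∣both)
  where
  go : ∀ N s s₁ q → + 2 * q ≡ N * N * (s - + 4 * s₁) →
    + 3 ∣ℤ (+ 2 - N) * (s - s₁) → + 3 ∣ℤ N * N - 1ℤ → + 3 ∣ℤ residual N s s₁ q
  go N s s₁ q 2q d₁ d₂ = ∣-resp
    -- 3x - 2x = x undoes the doubling modulo 3.
    (((∀ x → x * + 3 - + 2 * x ≡ x) ∋ solve-∀) (residual N s s₁ q))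
    (∣m∣n⇒∣m-n (∣n⇒∣m*n (residual N s s₁ q) (∣-refl {+ 3})) (∣-resp (sym 2residual)
      (∣m∣n⇒∣m+n (∣m∣n⇒∣m+n d₁ (∣m⇒∣m*n (N * s - + 20 * N * s₁ - + 8 * s₁) d₂))
                 (∣n⇒∣m*n ((- (+ 7 * N) - + 2) * s₁) (∣-refl {+ 3})))))
    where
    2residual : + 2 * residual N s s₁ q
      ≡ (+ 2 - N) * (s - s₁) + (N * N - 1ℤ) * (N * s - + 20 * N * s₁ - + 8 * s₁) + (- (+ 7 * N) - + 2) * s₁ * + 3
    2residual = trans
      (((∀ N s s₁ q → + 2 * (- (N * (+ 2 * (N * N) * s - + 5 * q)) - + 4 * (N * N) * s₁ - (N - 1ℤ) * s)
          ≡ + 5 * N * (+ 2 * q) - + 4 * (N * (N * N)) * s - + 8 * (N * N) * s₁ - + 2 * (N - 1ℤ) * s) ∋ solve-∀)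
        N s s₁ q)
      (trans (cong (λ z → + 5 * N * z - + 4 * (N * (N * N)) * s - + 8 * (N * N) * s₁ - + 2 * (N - 1ℤ) * s) 2q)
        (((∀ N s s₁ → + 5 * N * (N * N * (s - + 4 * s₁)) - + 4 * (N * (N * N)) * s - + 8 * (N * N) * s₁ - + 2 * (N - 1ℤ) * s
            ≡ (+ 2 - N) * (s - s₁) + (N * N - 1ℤ) * (N * s - + 20 * N * s₁ - + 8 * s₁)
              + (- (+ 7 * N) - + 2) * s₁ * + 3) ∋ solve-∀) N s s₁))
  3∣both : + 3 ∣ℤ (+ 2 - + suc n) * ((b ⋆ b) (suc n) - (b ⋆ b) n) × + 3 ∣ℤ + suc n * + suc n - 1ℤ
  3∣both with mod3 n
  ... | inj₁ d = ∣n⇒∣m*n (+ 2 - + suc n) (div (b⋆b-mod3 n d)) ,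
    ∣-resp (((∀ x → x * (x + + 2) ≡ (1ℤ + x) * (1ℤ + x) - 1ℤ) ∋ solve-∀) (+ n)) (∣m⇒∣m*n (+ n + + 2) d)
  ... | inj₂ (inj₁ d) = ⊥-elim (3∤n (∣⇒∣ᵤ d))
  ... | inj₂ (inj₂ d) =
    ∣m⇒∣m*n ((b ⋆ b) (suc n) - (b ⋆ b) n)
      (∣-resp (((∀ x → + 3 - (+ 2 + x) ≡ + 2 - (1ℤ + x)) ∋ solve-∀) (+ n)) (∣m∣n⇒∣m-n (∣-refl {+ 3}) d)) ,
    ∣-resp (((∀ x → (+ 2 + x) * x ≡ (1ℤ + x) * (1ℤ + x) - 1ℤ) ∋ solve-∀) (+ n)) (∣m⇒∣m*n (+ n) d)

-- Congruences modulo powers of an odd prime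

-- The prime is p = 2h + 1 with h = l + 1.
module OddPrime (p l : ℕ) (p-prime : Prime p) (p≡3+2l : p ≡ 3 ℕ.+ (l ℕ.+ l)) where

  h : ℕ
  h = suc l

  p≡1+2h : p ≡ suc (h ℕ.+ h)
  p≡1+2h = trans p≡3+2l (cong (suc ∘ suc) (sym (ℕ.+-suc l l)))

  P H : ℤ
  P = + p
  H = + h

  P≡1+2H : P ≡ 1ℤ + (H + H)
  P≡1+2H = cong +_ p≡1+2h

  instance
    P≢0 : ℤ.NonZero P
    P≢0 = prime⇒nonZero p-prime

  P∤suc : ∀ {s} → suc s ℕ.< p → ¬ P ∣ℤ + suc s
  P∤suc s<p d = ℕ.>⇒∤ s<p (∣⇒∣ᵤ d)

  P∤-* : ∀ {u v} → ¬ P ∣ℤ u → ¬ P ∣ℤ v → ¬ P ∣ℤ u * v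
  P∤-* {u} {v} P∤u P∤v d with euclidsLemma ∣ u ∣ ∣ v ∣ p-prime (subst (p ℕ.∣_) (abs-* u v) (∣⇒∣ᵤ d))
  ... | inj₁ e = P∤u (∣ᵤ⇒∣ e)
  ... | inj₂ e = P∤v (∣ᵤ⇒∣ e)

  -- What powers of P offer as moduli: factors prime to P can be cancelled. This takes the place of
  -- division by units, and `q` enters below through this property.
  Cancels : ℤ → Set
  Cancels M = ∀ u {a} → ¬ P ∣ℤ u → M ∣ℤ u * a → M ∣ℤ a

  cancels-1 : Cancels 1ℤ
  cancels-1 u {a} _ _ = divides a (sym (*-identityʳ a))

  cancels-P : Cancels P
  cancels-P u {a} P∤u d
    with euclidsLemma ∣ u ∣ ∣ a ∣ p-prime (subst (p ℕ.∣_) (abs-* u a) (∣⇒∣ᵤ d))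
  ... | inj₁ e = ⊥-elim (P∤u (∣ᵤ⇒∣ e))
  ... | inj₂ e = ∣ᵤ⇒∣ e

  cancels-* : ∀ {M} → Cancels M → Cancels (P * M)
  cancels-* {M} cM u {a} P∤u (divides k eq)
    with cancels-P u P∤u (divides (k * M) (trans eq (((∀ k M P → k * (P * M) ≡ k * M * P) ∋ solve-∀) k M P)))
  ... | divides a′ refl with cM u P∤u (divides k (*-cancelʳ-≡ (u * a′) (k * M) P
          (trans (((∀ u a P → u * a * P ≡ u * (a * P)) ∋ solve-∀) u a′ P)
            (trans eq (((∀ k M P → k * (P * M) ≡ k * M * P) ∋ solve-∀) k M P)))))
  ...   | divides a″ refl = divides a″ (((∀ a M P → a * M * P ≡ a * (P * M)) ∋ solve-∀) a″ M P)

  ≅-cancel : ∀ {M} → Cancels M → ∀ u {a b} → ¬ P ∣ℤ u → u * a ≅ u * b [ M ] → a ≅ b [ M ]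
  ≅-cancel cM u {a} {b} P∤u (mod d) =
    mod (cM u P∤u (∣-resp (((∀ u a b → u * a - u * b ≡ u * (a - b)) ∋ solve-∀) u a b) d))

  P∤∏ : ∀ n {f} → (∀ i → i ℕ.< n → ¬ P ∣ℤ f i) → ¬ P ∣ℤ ∏< n f
  P∤∏ zero    _   d = P∤suc {0} (subst (1 ℕ.<_) (sym p≡3+2l) (s≤s (s≤s z≤n))) d
  P∤∏ (suc n) P∤f = P∤-* (P∤∏ n λ i i<n → P∤f i (ℕ.m<n⇒m<1+n i<n)) (P∤f n (ℕ.n<1+n n))

  i<h⇒1+i<p : ∀ {i} → i ℕ.< h → suc i ℕ.< p
  i<h⇒1+i<p i<h = subst (_ ℕ.<_) (sym p≡1+2h) (s≤s (ℕ.≤-trans i<h (ℕ.m≤m+n h h)))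

  -- Fermat's little theorem

  P∣C : ∀ k → suc k ℕ.< p → P ∣ℤ + (p C suc k)
  P∣C k k<p with ℕ.m≤n⇒∃[o]m+o≡n k<p
  ... | o , eq = cancels-P (+ suc k) (P∤suc k<p) (divides (+ ((k ℕ.+ suc o) C k)) (begin
    + suc k * + (p C suc k)                        ≡⟨ cong (λ z → + suc k * + (z C suc k)) p≡ ⟩
    + suc k * + (suc (k ℕ.+ suc o) C suc k)        ≡⟨ C-absorb k (suc o) ⟩
    + suc (k ℕ.+ suc o) * + ((k ℕ.+ suc o) C k)    ≡⟨ cong (λ z → + z * + ((k ℕ.+ suc o) C k)) p≡ ⟨
    P * + ((k ℕ.+ suc o) C k)                      ≡⟨ *-comm P _ ⟩
    + ((k ℕ.+ suc o) C k) * P                      ∎))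
    where
    open ≡-Reasoning
    p≡ : p ≡ suc (k ℕ.+ suc o)
    p≡ = trans (sym eq) (cong suc (sym (ℕ.+-suc k o)))

  frobenius : ∀ x → (x + 1ℤ) ^ p ≅ x ^ p + 1ℤ [ P ]
  frobenius x = begin
    (x + 1ℤ) ^ p                               ≡⟨ pow-⋆ x 1ℤ p ⟨
    (pow x ⋆ pow 1ℤ) p                         ≡⟨ ⋆-∑ (pow x) (pow 1ℤ) p ⟩
    ∑< p t + t p                               ≡⟨ cong (λ z → ∑< z t + t p) p≡3+2l ⟩
    ∑< (suc (suc (suc (l ℕ.+ l)))) t + t p     ≡⟨ cong (_+ t p) (∑-first (suc (suc (l ℕ.+ l))) t) ⟩
    t 0 + ∑< (suc (suc (l ℕ.+ l))) (t ∘ suc) + t p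
      ≈⟨ +-≅ (+-≅ (≅-refl {a = t 0}) (≅-trans (∑-≅ _ λ i i<p →
           ≅0 (∣m⇒∣m*n _ (P∣C i (subst (suc i ℕ.<_) (sym p≡3+2l) (s≤s i<p)))))
           (≅-reflexive (∑-0 (suc (suc (l ℕ.+ l))))))) ≅-refl ⟩
    t 0 + 0ℤ + t p                             ≡⟨ cong₂ (λ y z → y + 0ℤ + z) t0 tp ⟩
    1ℤ + 0ℤ + x ^ p                            ≡⟨ ((∀ y → 1ℤ + 0ℤ + y ≡ y + 1ℤ) ∋ solve-∀) (x ^ p) ⟩
    x ^ p + 1ℤ                                 ∎
    where
    open ≅-Reasoning P
    t : ℕ → ℤ
    t k = + (p C k) * (x ^ k * 1ℤ ^ (p ∸ k))
    t0 : t 0 ≡ 1ℤ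
    t0 rewrite ^-zeroˡ p = refl
    tp : t p ≡ x ^ p
    tp rewrite nCn≡1 p | ^-zeroˡ (p ∸ p) = ((∀ a → 1ℤ * (a * 1ℤ) ≡ a) ∋ solve-∀) (x ^ p)

  fermat : ∀ s → (+ s) ^ p ≅ + s [ P ]
  fermat zero    rewrite p≡3+2l = ≅-refl
  fermat (suc s) = begin
    (+ suc s) ^ p      ≡⟨ cong (_^ p) (+-comm 1ℤ (+ s)) ⟩
    (+ s + 1ℤ) ^ p     ≈⟨ frobenius (+ s) ⟩
    (+ s) ^ p + 1ℤ     ≈⟨ +-≅ (fermat s) ≅-refl ⟩
    + s + 1ℤ           ≡⟨ +-comm (+ s) 1ℤ ⟩
    + suc s            ∎
    where open ≅-Reasoning P

  -- p - 3 is `l + l`, so Fermat's theorem reads s · s² · s^(p-3) ≡ s. The inverse of s² is an even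
  -- power, hence invariant under s ↦ p - s modulo p.
  fermat-inverse : ∀ {s} → suc s ℕ.< p → + suc s * + suc s * (+ suc s) ^ (l ℕ.+ l) ≅ 1ℤ [ P ]
  fermat-inverse {s} s<p = ≅-cancel cancels-P S (P∤suc s<p) (begin
    S * (S * S * S ^ (l ℕ.+ l))    ≡⟨ ((∀ S Y → S * (S * S * Y) ≡ S * (S * (S * Y))) ∋ solve-∀) S (S ^ (l ℕ.+ l)) ⟩
    S ^ (3 ℕ.+ (l ℕ.+ l))          ≡⟨ cong (S ^_) p≡3+2l ⟨
    S ^ p                          ≈⟨ fermat (suc s) ⟩
    S                              ≡⟨ *-identityʳ S ⟨
    S * 1ℤ                         ∎)
    where
    open ≅-Reasoning P
    S : ℤ
    S = + suc s

  -- Products of integers prime to p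

  α : ℕ → ℤ
  α i = + suc i * (P - + suc i)

  -- s (p - s) ≡ - s² modulo p, with s = i + 1.
  α⁻¹ : ℕ → ℤ
  α⁻¹ i = - ((+ suc i) ^ (l ℕ.+ l))

  αα⁻¹≅1 : ∀ {i} → i ℕ.< h → α i * α⁻¹ i ≅ 1ℤ [ P ]
  αα⁻¹≅1 {i} i<h = begin
    S * (P - S) * - Y         ≡⟨ ((∀ S P Y → S * (P - S) * - Y ≡ S * S * Y + (- (S * Y)) * P) ∋ solve-∀) S P Y ⟩
    S * S * Y + - (S * Y) * P ≈⟨ +-multiple-≅ (S * S * Y) (- (S * Y)) ⟩
    S * S * Y                 ≈⟨ fermat-inverse (i<h⇒1+i<p i<h) ⟩
    1ℤ                        ∎
    where
    open ≅-Reasoning P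
    S Y : ℤ
    S = + suc i
    Y = S ^ (l ℕ.+ l)

  π : ℤ → ℕ → ℤ
  π z n = ∏< n (λ i → α i + z)

  ∑α⁻¹ : ℕ → ℤ
  ∑α⁻¹ n = ∑< n α⁻¹

  -- κ ≡ - ∑_{s ≤ h} s⁻² is the logarithmic derivative of z ↦ ∏ (α i + z) at 0.
  κ : ℤ
  κ = ∑α⁻¹ h

  -- A first-order Taylor expansion. Both z and w being multiples of P, the logarithmic derivative
  -- may be taken at 0 and modulo P. The modulus keeps z - w itself, which will contain the index m.
  π-shift : ∀ {z w} → P ∣ℤ z → P ∣ℤ w → ∀ n → n ℕ.≤ h →
    π z n ≅ π w n + (z - w) * (π w n * ∑α⁻¹ n) [ P * (z - w) ]
  π-shift {z} {w} P∣z P∣w zero    _   = ≅-reflexive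
    (((∀ d → 1ℤ ≡ 1ℤ + d * (1ℤ * 0ℤ)) ∋ solve-∀) (z - w))
  π-shift {z} {w} P∣z P∣w (suc n) n<h with π-shift P∣z P∣w n (ℕ.<⇒≤ n<h)
  ... | mod d = ≅-from
      (((∀ πz πw z w a K v →
           (πz - (πw + (z - w) * (πw * K))) * (a + z) +
           πw * (((z * K - w * K) - (a * v - 1ℤ)) - w * v) * (z - w)
           ≡ πz * (a + z) - (πw * (a + w) + (z - w) * (πw * (a + w) * (K + v)))) ∋ solve-∀)
        (π z n) (π w n) z w (α n) (∑α⁻¹ n) (α⁻¹ n))
      (∣m∣n⇒∣m+n (∣m⇒∣m*n (α n + z) d)
        (*-monoˡ-∣ (z - w) {P} (∣n⇒∣m*n (π w n)
          (∣m∣n⇒∣m-n (∣m∣n⇒∣m-n (∣m∣n⇒∣m-n (∣m⇒∣m*n (∑α⁻¹ n) P∣z) (∣m⇒∣m*n (∑α⁻¹ n) P∣w))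
                                 (div (αα⁻¹≅1 n<h)))
                     (∣m⇒∣m*n (α⁻¹ n) P∣w)))))

  -- g j is the product of the integers strictly between jp and (j + 1)p, where jp + s and
  -- (j + 1)p - s contribute s(p - s) + p² j(j + 1); hence (ap)! = p^a a! F(a).
  g F : ℕ → ℤ
  g j = π (P * P * (+ j * (+ j + 1ℤ))) h
  F a = ∏< a g

  P³ : ℤ
  P³ = P * (P * P)

  g-shift : ∀ m j → g (m ℕ.+ j) ≅ g j * (1ℤ + P * P * (κ * (+ m * (+ m + + 2 * + j + 1ℤ)))) [ P³ * + m ]
  g-shift m j = ≅-trans
    (≅-weaken (divides (M + + 2 * J + 1ℤ)
        (((∀ P M J → P * (P * P * ((M + J) * ((M + J) + 1ℤ)) - P * P * (J * (J + 1ℤ)))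
            ≡ (M + + 2 * J + 1ℤ) * (P * (P * P) * M)) ∋ solve-∀) P M J))
      (π-shift (∣m⇒∣m*n _ (∣m⇒∣m*n P ∣-refl)) (∣m⇒∣m*n _ (∣m⇒∣m*n P ∣-refl)) h ℕ.≤-refl))
    (≅-reflexive (((∀ P M J G K → G + (P * P * ((M + J) * ((M + J) + 1ℤ)) - P * P * (J * (J + 1ℤ))) * (G * K)
       ≡ G * (1ℤ + P * P * (K * (M * (M + + 2 * J + 1ℤ))))) ∋ solve-∀) P M J (g j) κ))
    where
    M J : ℤ
    M = + m
    J = + j

  -- Over j < r the first-order terms of `g-shift` add up by ∑ (m + 2j + 1) = r (m + r), while the
  -- cross terms contain P⁴ m² and disappear.
  F-+ : ∀ m r → F (m ℕ.+ r) ≅ F m * F r * (1ℤ + P * P * (κ * (+ m * (+ r * (+ m + + r))))) [ P³ * + m ]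
  F-+ m zero    rewrite ℕ.+-identityʳ m = ≅-reflexive
    (((∀ f x y z w → f ≡ f * 1ℤ * (1ℤ + x * (y * (z * (0ℤ * w))))) ∋ solve-∀) (F m) (P * P) κ (+ m) (+ m + 0ℤ))
  F-+ m (suc r) = begin
    F (m ℕ.+ suc r)
      ≡⟨ cong F (ℕ.+-suc m r) ⟩
    F (m ℕ.+ r) * g (m ℕ.+ r)
      ≈⟨ *-≅ (F-+ m r) (g-shift m r) ⟩
    F m * F r * (1ℤ + P * P * (κ * (M * (R * (M + R))))) * (g r * (1ℤ + P * P * (κ * (M * (M + + 2 * R + 1ℤ)))))
      ≡⟨ ((∀ P M R K f f′ g →
            f * f′ * (1ℤ + P * P * (K * (M * (R * (M + R))))) * (g * (1ℤ + P * P * (K * (M * (M + + 2 * R + 1ℤ)))))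
            ≡ f * (f′ * g) * (1ℤ + P * P * (K * (M * ((1ℤ + R) * (M + (1ℤ + R))))))
              + f * (f′ * g) * P * (K * K * (R * (M + R)) * M * (M + + 2 * R + 1ℤ)) * (P * (P * P) * M)) ∋ solve-∀)
          P M R κ (F m) (F r) (g r) ⟩
    F m * F (suc r) * (1ℤ + P * P * (κ * (M * (+ suc r * (M + + suc r))))) + rest * (P³ * M)
      ≈⟨ +-multiple-≅ (F m * F (suc r) * (1ℤ + P * P * (κ * (M * (+ suc r * (M + + suc r)))))) rest ⟩
    F m * F (suc r) * (1ℤ + P * P * (κ * (M * (+ suc r * (M + + suc r))))) ∎
    where
    open ≅-Reasoning (P³ * + m)
    M R rest : ℤ
    M = + m
    R = + r
    rest = F m * (F r * g r) * P * (κ * κ * (R * (M + R)) * M * (M + + 2 * R + 1ℤ))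

  ∏-block : ∀ j → ∏< p (λ i → + suc (j ℕ.* p ℕ.+ i)) ≡ g j * (P * + suc j)
  ∏-block j = begin
    ∏< p t                                       ≡⟨ cong (λ z → ∏< z t) p≡1+2h ⟩
    ∏< (h ℕ.+ h) t * t (h ℕ.+ h)                 ≡⟨ cong₂ _*_ halves middle ⟩
    g j * (P * + suc j)                          ∎
    where
    open ≡-Reasoning
    t : ℕ → ℤ
    t i = + suc (j ℕ.* p ℕ.+ i)
    middle : t (h ℕ.+ h) ≡ P * + suc j
    middle = trans (cong₂ (λ y z → 1ℤ + (y + z)) (pos-* j p) refl)
      (lemma (+ j) H P P≡1+2H)
      where
      lemma : ∀ J H P → P ≡ 1ℤ + (H + H) → 1ℤ + (J * P + (H + H)) ≡ P * (1ℤ + J)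
      lemma J H _ refl = ((∀ J H → 1ℤ + (J * (1ℤ + (H + H)) + (H + H)) ≡ (1ℤ + (H + H)) * (1ℤ + J)) ∋ solve-∀) J H
    pair : ∀ i → i ℕ.< h → t i * t (h ℕ.+ (h ∸ suc i)) ≡ α i + P * P * (+ j * (+ j + 1ℤ))
    pair i i<h = trans
      (cong (λ z → (1ℤ + (z + + i)) * (1ℤ + (z + (H + + (h ∸ suc i))))) (pos-* j p))
      (lemma (+ j) (+ i) (+ (h ∸ suc i)) H P (cong +_ (sym (ℕ.m∸n+n≡m i<h))) P≡1+2H)
      where
      lemma : ∀ J I X H P → H ≡ X + (1ℤ + I) → P ≡ 1ℤ + (H + H) →
        (1ℤ + (J * P + I)) * (1ℤ + (J * P + (H + X))) ≡ (1ℤ + I) * (P - (1ℤ + I)) + P * P * (J * (J + 1ℤ))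
      lemma J I X _ _ refl refl = ((∀ J I X →
        (1ℤ + (J * (1ℤ + ((X + (1ℤ + I)) + (X + (1ℤ + I)))) + I)) * (1ℤ + (J * (1ℤ + ((X + (1ℤ + I)) + (X + (1ℤ + I)))) + ((X + (1ℤ + I)) + X)))
        ≡ (1ℤ + I) * ((1ℤ + ((X + (1ℤ + I)) + (X + (1ℤ + I)))) - (1ℤ + I))
          + (1ℤ + ((X + (1ℤ + I)) + (X + (1ℤ + I)))) * (1ℤ + ((X + (1ℤ + I)) + (X + (1ℤ + I)))) * (J * (J + 1ℤ))) ∋ solve-∀) J I X
    halves : ∏< (h ℕ.+ h) t ≡ g j
    halves = begin
      ∏< (h ℕ.+ h) t                                          ≡⟨ ∏-append h h t ⟩
      ∏< h t * ∏< h (λ i → t (h ℕ.+ i))                       ≡⟨ cong (∏< h t *_) (∏-reverse h (λ i → t (h ℕ.+ i))) ⟩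
      ∏< h t * ∏< h (λ i → t (h ℕ.+ (h ∸ suc i)))             ≡⟨ ∏-* h t (λ i → t (h ℕ.+ (h ∸ suc i))) ⟩
      ∏< h (λ i → t i * t (h ℕ.+ (h ∸ suc i)))                ≡⟨ ∏-cong h pair ⟩
      g j                                                     ∎

  -- Factorials and binomials at multiples of p

  fact-p : ∀ a → fact (a ℕ.* p) ≡ P ^ a * (fact a * F a)
  fact-p zero    = refl
  fact-p (suc a) = begin
    fact (p ℕ.+ a ℕ.* p)                                   ≡⟨ cong fact (ℕ.+-comm p (a ℕ.* p)) ⟩
    fact (a ℕ.* p ℕ.+ p)                                   ≡⟨ fact-+ (a ℕ.* p) p ⟩
    fact (a ℕ.* p) * ∏< p (λ i → + suc (a ℕ.* p ℕ.+ i))    ≡⟨ cong₂ _*_ (fact-p a) (∏-block a) ⟩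
    P ^ a * (fact a * F a) * (g a * (P * + suc a))
      ≡⟨ ((∀ Q f F g P s → Q * (f * F) * (g * (P * s)) ≡ P * Q * (s * f * (F * g))) ∋ solve-∀)
           (P ^ a) (fact a) (F a) (g a) P (+ suc a) ⟩
    P * P ^ a * (+ suc a * fact a * (F a * g a))
      ≡⟨ cong (λ z → P * P ^ a * (z * (F a * g a))) (fact-suc a) ⟨
    P * P ^ a * (fact (suc a) * (F a * g a))               ∎
    where open ≡-Reasoning

  -- An exact identity: the powers of P in the three factorials cancel and leave the parts prime to
  -- P.
  C-p : ∀ r m → + ((r ℕ.* p ℕ.+ m ℕ.* p) C (r ℕ.* p)) * (F r * F m) ≡ + ((r ℕ.+ m) C r) * F (r ℕ.+ m)
  C-p r m = *-cancelˡ-≡ (P ^ (r ℕ.+ m) * (fact r * fact m)) _ _ {{nz}} (begin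
    P ^ (r ℕ.+ m) * (fact r * fact m) * (X * (F r * F m))
      ≡⟨ cong (λ z → z * (fact r * fact m) * (X * (F r * F m))) (^-distribˡ-+-* P r m) ⟩
    P ^ r * P ^ m * (fact r * fact m) * (X * (F r * F m))
      ≡⟨ ((∀ a b c d X e f → a * b * (c * d) * (X * (e * f)) ≡ X * ((a * (c * e)) * (b * (d * f)))) ∋ solve-∀)
           (P ^ r) (P ^ m) (fact r) (fact m) X (F r) (F m) ⟩
    X * ((P ^ r * (fact r * F r)) * (P ^ m * (fact m * F m)))
      ≡⟨ cong₂ (λ y z → X * (y * z)) (fact-p r) (fact-p m) ⟨
    X * (fact (r ℕ.* p) * fact (m ℕ.* p))
      ≡⟨ C-fact (r ℕ.* p) (m ℕ.* p) ⟩
    fact (r ℕ.* p ℕ.+ m ℕ.* p)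
      ≡⟨ cong fact (ℕ.*-distribʳ-+ p r m) ⟨
    fact ((r ℕ.+ m) ℕ.* p)
      ≡⟨ fact-p (r ℕ.+ m) ⟩
    P ^ (r ℕ.+ m) * (fact (r ℕ.+ m) * F (r ℕ.+ m))
      ≡⟨ cong (λ z → P ^ (r ℕ.+ m) * (z * F (r ℕ.+ m))) (C-fact r m) ⟨
    P ^ (r ℕ.+ m) * (x * (fact r * fact m) * F (r ℕ.+ m))
      ≡⟨ ((∀ a x c f → a * (x * c * f) ≡ a * c * (x * f)) ∋ solve-∀)
           (P ^ (r ℕ.+ m)) x (fact r * fact m) (F (r ℕ.+ m)) ⟩
    P ^ (r ℕ.+ m) * (fact r * fact m) * (x * F (r ℕ.+ m)) ∎)
    where
    open ≡-Reasoning
    X x : ℤ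
    X = + ((r ℕ.* p ℕ.+ m ℕ.* p) C (r ℕ.* p))
    x = + ((r ℕ.+ m) C r)
    P^≢0 : ∀ a → ℤ.NonZero (P ^ a)
    P^≢0 zero    = _
    P^≢0 (suc a) = i*j≢0 P (P ^ a) {{P≢0}} {{P^≢0 a}}
    nz : ℤ.NonZero (P ^ (r ℕ.+ m) * (fact r * fact m))
    nz = i*j≢0 (P ^ (r ℕ.+ m)) (fact r * fact m) {{P^≢0 (r ℕ.+ m)}} {{fact*fact≢0 r m}}

  P∤α : ∀ {i} → i ℕ.< h → ¬ P ∣ℤ α i
  P∤α {i} i<h d = P∤suc {0} (ℕ.≤-trans (s≤s (s≤s z≤n)) (i<h⇒1+i<p i<h))
    (≅-∣ (≅-sym (αα⁻¹≅1 i<h)) (∣m⇒∣m*n (α⁻¹ i) d))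

  P∤F : ∀ a → ¬ P ∣ℤ F a
  P∤F a = P∤∏ a λ j _ → P∤∏ h λ i i<h d → P∤α i<h
    (∣m+n∣n⇒∣m d (∣m⇒∣m*n (+ j * (+ j + 1ℤ)) (∣m⇒∣m*n P ∣-refl)))

  -- Jacobsthal's congruence C(pn, pr) ≡ C(n, r), with its error term.
  C-shift : ∀ {q} → Cancels q → ∀ w r m → q ∣ℤ w * + ((r ℕ.+ m) C r) * + m →
    w * + ((r ℕ.* p ℕ.+ m ℕ.* p) C (r ℕ.* p))
      ≅ w * (+ ((r ℕ.+ m) C r) * (1ℤ + P * P * (κ * (+ m * (+ r * (+ m + + r)))))) [ P * (P * (P * q)) ]
  C-shift {q} cq w r m (divides k eq) with F-+ m r
  ... | mod (divides j eq′) = mod (cancels-* (cancels-* (cancels-* cq)) (F m * F r)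
    (P∤-* {F m} {F r} (P∤F m) (P∤F r)) (divides (j * k) (begin
      F m * F r * (w * X - w * (x * A))
        ≡⟨ ((∀ a b w X x A → a * b * (w * X - w * (x * A)) ≡ w * (X * (b * a)) - w * x * (a * b * A)) ∋ solve-∀)
             (F m) (F r) w X x A ⟩
      w * (X * (F r * F m)) - w * x * (F m * F r * A)
        ≡⟨ cong (λ z → w * z - w * x * (F m * F r * A)) (trans (C-p r m) (cong (λ z → x * F z) (ℕ.+-comm r m))) ⟩
      w * (x * F (m ℕ.+ r)) - w * x * (F m * F r * A)
        ≡⟨ ((∀ w x f y → w * (x * f) - w * x * y ≡ w * x * (f - y)) ∋ solve-∀) w x (F (m ℕ.+ r)) (F m * F r * A) ⟩
      w * x * (F (m ℕ.+ r) - F m * F r * A)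
        ≡⟨ cong (w * x *_) eq′ ⟩
      w * x * (j * (P * (P * P) * + m))
        ≡⟨ ((∀ y j P m → y * (j * (P * (P * P) * m)) ≡ j * (y * m) * (P * (P * P))) ∋ solve-∀) (w * x) j P (+ m) ⟩
      j * (w * x * + m) * (P * (P * P))
        ≡⟨ cong (λ z → j * z * (P * (P * P))) eq ⟩
      j * (k * q) * (P * (P * P))
        ≡⟨ ((∀ j k q P → j * (k * q) * (P * (P * P)) ≡ j * k * (P * (P * (P * q)))) ∋ solve-∀) j k q P ⟩
      j * k * (P * (P * (P * q))) ∎)))
    where
    open ≡-Reasoning
    X x A : ℤ
    X = + ((r ℕ.* p ℕ.+ m ℕ.* p) C (r ℕ.* p))
    x = + ((r ℕ.+ m) C r)
    A = 1ℤ + P * P * (κ * (+ m * (+ r * (+ m + + r))))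

  -- b(r) and b(m) are binomials too, so `C-shift` applies three times; for these two the weight w
  -- is C(n, r), which supplies the divisibility by q that r or m alone may lack. With n = r + m the
  -- errors sum to m r n + 2r³ + 2m³ = n (2n² - 5rm).
  multiple-block : ∀ {q} → Cancels q → ∀ r m → q ∣ℤ + (r ℕ.+ m) →
    + ((r ℕ.* p ℕ.+ m ℕ.* p) C (r ℕ.* p)) * (b (r ℕ.* p) * b (m ℕ.* p))
      ≅ + ((r ℕ.+ m) C r) * (b r * b m)
        * (1ℤ + P * P * (κ * ((+ r + + m) * (+ 2 * ((+ r + + m) * (+ r + + m)) - + 5 * (+ r * + m)))))
      [ P * (P * (P * q)) ]
  multiple-block {q} cq r m q∣n = begin
    X * (Y * Z)
      ≡⟨ ((∀ X Y → X * Y ≡ 1ℤ * X * Y) ∋ solve-∀) X (Y * Z) ⟩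
    1ℤ * X * (Y * Z)
      ≈⟨ *-≅ (C-shift cq 1ℤ r m (∣-resp (cong (_* M) (sym (*-identityˡ x))) q∣xm)) (≅-refl {a = Y * Z}) ⟩
    1ℤ * (x * (1ℤ + P * P * (κ * (M * (R * (M + R)))))) * (Y * Z)
      ≡⟨ ((∀ x A Y Z → 1ℤ * (x * A) * (Y * Z) ≡ x * Y * (A * Z)) ∋ solve-∀) x A Y Z ⟩
    x * Y * (A * Z)
      ≈⟨ *-≅ (C-shift cq x r r (∣-resp (((∀ x R y → x * R * y ≡ x * y * R) ∋ solve-∀) x R y) (∣m⇒∣m*n y q∣xr)))
             (≅-refl {a = A * Z}) ⟩
    x * (y * (1ℤ + P * P * (κ * (R * (R * (R + R)))))) * (A * Z)
      ≡⟨ ((∀ x y B A Z → x * (y * B) * (A * Z) ≡ x * Z * (y * (B * A))) ∋ solve-∀) x y B A Z ⟩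
    x * Z * (y * (B * A))
      ≈⟨ *-≅ (C-shift cq x m m (∣-resp (((∀ x M z → x * M * z ≡ x * z * M) ∋ solve-∀) x M z) (∣m⇒∣m*n z q∣xm)))
             (≅-refl {a = y * (B * A)}) ⟩
    x * (z * (1ℤ + P * P * (κ * (M * (M * (M + M)))))) * (y * (B * A))
      ≡⟨ ((∀ x y z P K e₁ e₂ e₃ → x * (z * (1ℤ + P * P * (K * e₃))) * (y * ((1ℤ + P * P * (K * e₂)) * (1ℤ + P * P * (K * e₁))))
           ≡ x * (y * z) * (1ℤ + P * P * (K * (e₁ + e₂ + e₃)))
             + y * z * P * (K * K) * (P * (P * P) * (x * (e₁ * e₂ + e₁ * e₃ + e₂ * e₃ + P * P * (K * (e₁ * e₂ * e₃)))))) ∋ solve-∀)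
           x y z P κ e₁ e₂ e₃ ⟩
    x * (y * z) * (1ℤ + P * P * (κ * (e₁ + e₂ + e₃)))
      + y * z * P * (κ * κ) * (P * (P * P) * (x * (e₁ * e₂ + e₁ * e₃ + e₂ * e₃ + P * P * (κ * (e₁ * e₂ * e₃)))))
      -- Every product of two errors contains e₁ or e₂, hence a factor R, and q divides x R; so the
      -- cross terms vanish too.
      ≡⟨ cong₂ (λ s t → x * (y * z) * (1ℤ + P * P * (κ * s)) + y * z * P * (κ * κ) * (P * (P * P) * t))
           (((∀ R M → M * (R * (M + R)) + R * (R * (R + R)) + M * (M * (M + M))
                    ≡ (R + M) * (+ 2 * ((R + M) * (R + M)) - + 5 * (R * M))) ∋ solve-∀) R M)
           (trans (cong (x *_) uvw) (((∀ x R e₁ e₂ e₃ K → x * (R * e₁ * (R * e₂) + R * e₁ * e₃ + R * e₂ * e₃ + K * (R * e₁ * (R * e₂) * e₃))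
                            ≡ (R * e₁ * e₂ + e₁ * e₃ + e₂ * e₃ + K * (R * e₁ * e₂ * e₃)) * (x * R)) ∋ solve-∀)
              x R (M * (M + R)) (R * (R + R)) e₃ (P * P * κ))) ⟩
    goal + y * z * P * (κ * κ) * (P * (P * P) * (rest′ * (x * R)))
      ≡⟨ ((∀ g c Q r x → g + c * (Q * (r * x)) ≡ g + c * r * (Q * x)) ∋ solve-∀)
           goal (y * z * P * (κ * κ)) (P * (P * P)) rest′ (x * R) ⟩
    goal + rest * (P * (P * P) * (x * R))
      ≡⟨ cong (λ e₃ → goal + rest * (P * (P * P) * e₃)) (_∣ℤ_.equality q∣xr) ⟩
    goal + rest * (P * (P * P) * (quotient q∣xr * q))
      ≡⟨ ((∀ g c P k q → g + c * (P * (P * P) * (k * q)) ≡ g + c * k * (P * (P * (P * q)))) ∋ solve-∀)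
           goal rest P (quotient q∣xr) q ⟩
    goal + rest * quotient q∣xr * (P * (P * (P * q)))
      ≈⟨ +-multiple-≅ goal (rest * quotient q∣xr) ⟩
    goal ∎
    where
    open ≅-Reasoning (P * (P * (P * q)))
    X Y Z x y z R M A B e₁ e₂ e₃ rest′ goal rest : ℤ
    X = + ((r ℕ.* p ℕ.+ m ℕ.* p) C (r ℕ.* p))
    Y = b (r ℕ.* p)
    Z = b (m ℕ.* p)
    x = + ((r ℕ.+ m) C r)
    y = b r
    z = b m
    R = + r
    M = + m
    A = 1ℤ + P * P * (κ * (M * (R * (M + R))))
    B = 1ℤ + P * P * (κ * (R * (R * (R + R))))
    goal = x * (y * z) * (1ℤ + P * P * (κ * ((R + M) * (+ 2 * ((R + M) * (R + M)) - + 5 * (R * M)))))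
    e₁ = M * (R * (M + R))
    e₂ = R * (R * (R + R))
    e₃ = M * (M * (M + M))
    u′ v′ : ℤ
    u′ = M * (M + R)
    v′ = R * (R + R)
    rest′ = R * u′ * v′ + u′ * e₃ + v′ * e₃ + P * P * κ * (R * u′ * v′ * e₃)
    rest = y * z * P * (κ * κ) * rest′
    uvw : e₁ * e₂ + e₁ * e₃ + e₂ * e₃ + P * P * (κ * (e₁ * e₂ * e₃))
      ≡ R * u′ * (R * v′) + R * u′ * e₃ + R * v′ * e₃ + P * P * κ * (R * u′ * (R * v′) * e₃)
    uvw = trans (cong (λ e₁ → e₁ * e₂ + e₁ * e₃ + e₂ * e₃ + P * P * (κ * (e₁ * e₂ * e₃)))
        (((∀ M R → M * (R * (M + R)) ≡ R * (M * (M + R))) ∋ solve-∀) M R))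
      (cong (λ z → R * u′ * (R * v′) + R * u′ * e₃ + R * v′ * e₃ + z) (sym (*-assoc (P * P) κ (R * u′ * (R * v′) * e₃))))
    q∣xr : q ∣ℤ x * R
    q∣xr = ∣-trans q∣n (∣-absorb r m)
    q∣xm : q ∣ℤ x * M
    q∣xm = ∣-trans q∣n (∣-absorbʳ r m)

  -- Central binomial coefficients modulo p and p²

  b-p : ∀ r → b (r ℕ.* p) ≅ b r [ P ]
  b-p r = begin
    b (r ℕ.* p)                  ≡⟨ *-identityˡ (b (r ℕ.* p)) ⟨
    1ℤ * b (r ℕ.* p)
      ≈⟨ ≅-weaken (∣m⇒∣m*n (P * (P * 1ℤ)) ∣-refl)
           (C-shift cancels-1 1ℤ r r (divides (1ℤ * b r * + r) (sym (*-identityʳ (1ℤ * b r * + r))))) ⟩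
    1ℤ * (b r * (1ℤ + P * P * e)) ≡⟨ ((∀ B P e → 1ℤ * (B * (1ℤ + P * P * e)) ≡ B + B * P * e * P) ∋ solve-∀) (b r) P e ⟩
    b r + b r * P * e * P         ≈⟨ +-multiple-≅ (b r) (b r * P * e) ⟩
    b r                           ∎
    where
    open ≅-Reasoning P
    e : ℤ
    e = κ * (+ r * (+ r * (+ r + + r)))

  -- Modulo P the coefficients of the recurrence of `b` at rp + i depend only on i, and the leading
  -- one, i + 1 < p, can be cancelled.
  b-lucas : ∀ r i → i ℕ.< p → b (r ℕ.* p ℕ.+ i) ≅ b r * b i [ P ]
  b-lucas r zero    _   = begin
    b (r ℕ.* p ℕ.+ 0)   ≡⟨ cong b (ℕ.+-identityʳ (r ℕ.* p)) ⟩
    b (r ℕ.* p)         ≈⟨ b-p r ⟩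
    b r                 ≡⟨ *-identityʳ (b r) ⟨
    b r * b 0           ∎
    where open ≅-Reasoning P
  b-lucas r (suc i) i<p = ≅-cancel cancels-P (+ suc i) (P∤suc i<p) (begin
    + suc i * b (r ℕ.* p ℕ.+ suc i)     ≡⟨ cong (λ z → + suc i * b z) (ℕ.+-suc (r ℕ.* p) i) ⟩
    + suc i * b (suc k)
      ≈⟨ ≅-sym (+-multiple-≅ (+ suc i * b (suc k)) (+ r * b (suc k))) ⟩
    + suc i * b (suc k) + + r * b (suc k) * P
      ≡⟨ ((∀ I R B P → (1ℤ + I) * B + R * B * P ≡ (1ℤ + (R * P + I)) * B) ∋ solve-∀) (+ i) (+ r) (b (suc k)) P ⟩
    (1ℤ + (+ r * P + + i)) * b (suc k)  ≡⟨ cong (λ z → (1ℤ + (z + + i)) * b (suc k)) (pos-* r p) ⟨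
    + suc k * b (suc k)                 ≡⟨ b-suc k ⟩
    + 2 * (+ 2 * + k + 1ℤ) * b k        ≡⟨ cong (λ z → + 2 * (+ 2 * (z + + i) + 1ℤ) * b k) (pos-* r p) ⟩
    + 2 * (+ 2 * (+ r * P + + i) + 1ℤ) * b k
      ≡⟨ ((∀ I R B P → + 2 * (+ 2 * (R * P + I) + 1ℤ) * B ≡ + 2 * (+ 2 * I + 1ℤ) * B + + 4 * R * B * P) ∋ solve-∀)
           (+ i) (+ r) (b k) P ⟩
    + 2 * (+ 2 * + i + 1ℤ) * b k + + 4 * + r * b k * P
      ≈⟨ +-multiple-≅ (+ 2 * (+ 2 * + i + 1ℤ) * b k) (+ 4 * + r * b k) ⟩
    + 2 * (+ 2 * + i + 1ℤ) * b k        ≈⟨ *-≅ˡ (+ 2 * (+ 2 * + i + 1ℤ)) (b-lucas r i (ℕ.<⇒≤ i<p)) ⟩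
    + 2 * (+ 2 * + i + 1ℤ) * (b r * b i)
      ≡⟨ ((∀ c r i → c * (r * i) ≡ r * (c * i)) ∋ solve-∀) (+ 2 * (+ 2 * + i + 1ℤ)) (b r) (b i) ⟩
    b r * (+ 2 * (+ 2 * + i + 1ℤ) * b i)  ≡⟨ cong (b r *_) (b-suc i) ⟨
    b r * (+ suc i * b (suc i))
      ≡⟨ ((∀ r s i → r * (s * i) ≡ s * (r * i)) ∋ solve-∀) (b r) (+ suc i) (b (suc i)) ⟩
    + suc i * (b r * b (suc i))         ∎)
    where
    open ≅-Reasoning P
    k : ℕ
    k = r ℕ.* p ℕ.+ i

  P∤2 : ¬ P ∣ℤ + 2
  P∤2 = P∤suc (subst (2 ℕ.<_) (sym p≡3+2l) (s≤s (s≤s (s≤s z≤n))))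

  -- Modulo p², running the recurrence of b upwards from 0 and downwards from Mp keeps
  -- s b(s) b(Mp - s) constant in s = i + 1.
  b-reflect : ∀ M i → i ℕ.< h → ∀ j → j ℕ.+ suc i ≡ M ℕ.* p →
    P ∣ℤ b j × + suc i * b (suc i) * b j ≅ - (P * + M * b (M ℕ.* p)) [ P * P ]
  b-reflect M zero    _   j eq = P∣bj , ≅-from
      (trans (sym (trans (cong (λ z → + 2 * z + P * + M * B) bj≡) eq₂))
        (((∀ x y → + 2 * x + y ≡ 1ℤ * + 2 * x - - y) ∋ solve-∀) (b j) (P * + M * B)))
      (divides (+ 4 * + M * k) refl)
    where
    open ≡-Reasoning
    B : ℤ
    B = b (M ℕ.* p)
    1+j≡ : suc j ≡ M ℕ.* p
    1+j≡ = trans (ℕ.+-comm 1 j) eq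
    -- The recurrence at j = Mp - 1. As b(1) = 2, it shows first that P divides b(j) and then,
    -- modulo P², the claim for s = 1.
    eq₁ : P * + M * B ≡ + 4 * (P * + M) * b j - + 2 * b j
    eq₁ = begin
      P * + M * B                        ≡⟨ cong (_* B) (trans (*-comm P (+ M)) (sym (pos-* M p))) ⟩
      + (M ℕ.* p) * B                    ≡⟨ cong (λ z → + z * b z) 1+j≡ ⟨
      + suc j * b (suc j)                ≡⟨ b-suc j ⟩
      + 2 * (+ 2 * + j + 1ℤ) * b j
        ≡⟨ ((∀ J b → + 2 * (+ 2 * J + 1ℤ) * b ≡ + 4 * (1ℤ + J) * b - + 2 * b) ∋ solve-∀) (+ j) (b j) ⟩
      + 4 * + suc j * b j - + 2 * b j
        ≡⟨ cong (λ z → + 4 * z * b j - + 2 * b j) (trans (cong +_ 1+j≡) (trans (pos-* M p) (*-comm (+ M) P))) ⟩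
      + 4 * (P * + M) * b j - + 2 * b j  ∎
    P∣bj : P ∣ℤ b j
    P∣bj = cancels-P (+ 2) P∤2 (divides (+ 4 * + M * b j - + M * B) (begin
      + 2 * b j                                          ≡⟨ ((∀ x y → x ≡ y - (y - x)) ∋ solve-∀) (+ 2 * b j) (+ 4 * (P * + M) * b j) ⟩
      + 4 * (P * + M) * b j - (+ 4 * (P * + M) * b j - + 2 * b j)  ≡⟨ cong (λ z → + 4 * (P * + M) * b j - z) eq₁ ⟨
      + 4 * (P * + M) * b j - P * + M * B
        ≡⟨ ((∀ P M b B → + 4 * (P * M) * b - P * M * B ≡ (+ 4 * M * b - M * B) * P) ∋ solve-∀) P (+ M) (b j) B ⟩
      (+ 4 * + M * b j - + M * B) * P                    ∎))
    k : ℤ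
    k = quotient P∣bj
    bj≡ : b j ≡ k * P
    bj≡ = _∣ℤ_.equality P∣bj
    eq₂ : + 2 * (k * P) + P * + M * B ≡ + 4 * + M * k * (P * P)
    eq₂ = begin
      + 2 * (k * P) + P * + M * B         ≡⟨ cong₂ (λ y z → + 2 * y + z) (sym bj≡) eq₁ ⟩
      + 2 * b j + (+ 4 * (P * + M) * b j - + 2 * b j)
        ≡⟨ ((∀ x y → x + (y - x) ≡ y) ∋ solve-∀) (+ 2 * b j) (+ 4 * (P * + M) * b j) ⟩
      + 4 * (P * + M) * b j               ≡⟨ cong (+ 4 * (P * + M) *_) bj≡ ⟩
      + 4 * (P * + M) * (k * P)           ≡⟨ ((∀ P M k → + 4 * (P * M) * (k * P) ≡ + 4 * M * k * (P * P)) ∋ solve-∀) P (+ M) k ⟩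
      + 4 * + M * k * (P * P)             ∎
  b-reflect M (suc i) i<h j eq with b-reflect M i (ℕ.<⇒≤ i<h) (suc j) (trans (sym (ℕ.+-suc j (suc i))) eq)
  ... | P∣bj₁@(divides k bj₁≡) , ih = P∣bj , (begin
      + suc (suc i) * b (suc (suc i)) * b j
        ≡⟨ cong (_* b j) (b-suc (suc i)) ⟩
      c * b (suc i) * b j
        ≡⟨ ((∀ c x y → c * x * y ≡ x * (c * y)) ∋ solve-∀) c (b (suc i)) (b j) ⟩
      b (suc i) * (c * b j)
        ≡⟨ cong (b (suc i) *_) eq₁ ⟩
      b (suc i) * (+ 4 * (P * + M) * b j - (P * + M - + suc i) * b (suc j))
        ≡⟨ ((∀ x P M y s z → x * (+ 4 * (P * M) * y - (P * M - s) * z) ≡ s * x * z + x * M * (+ 4 * y - z) * P) ∋ solve-∀)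
             (b (suc i)) P (+ M) (b j) (+ suc i) (b (suc j)) ⟩
      + suc i * b (suc i) * b (suc j) + b (suc i) * + M * (+ 4 * b j - b (suc j)) * P
        ≡⟨ cong₂ (λ y z → + suc i * b (suc i) * b (suc j) + b (suc i) * + M * (+ 4 * y - z) * P) (_∣ℤ_.equality P∣bj) bj₁≡ ⟩
      + suc i * b (suc i) * b (suc j) + b (suc i) * + M * (+ 4 * (quotient P∣bj * P) - k * P) * P
        ≡⟨ ((∀ a x M y z P → a + x * M * (+ 4 * (y * P) - z * P) * P ≡ a + x * M * (+ 4 * y - z) * (P * P)) ∋ solve-∀)
             (+ suc i * b (suc i) * b (suc j)) (b (suc i)) (+ M) (quotient P∣bj) k P ⟩
      + suc i * b (suc i) * b (suc j) + b (suc i) * + M * (+ 4 * quotient P∣bj - k) * (P * P)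
        ≈⟨ +-multiple-≅ (+ suc i * b (suc i) * b (suc j)) (b (suc i) * + M * (+ 4 * quotient P∣bj - k)) ⟩
      + suc i * b (suc i) * b (suc j)
        ≈⟨ ih ⟩
      - (P * + M * b (M ℕ.* p)) ∎)
    where
    open ≅-Reasoning (P * P)
    c : ℤ
    c = + 2 * (+ 2 * + suc i + 1ℤ)
    j+2+i : + j + + suc (suc i) ≡ P * + M
    j+2+i = trans (cong +_ eq) (trans (pos-* M p) (*-comm (+ M) P))
    -- For j = Mp - (i + 2) the coefficient 2 (2j + 1) is 4PM - c: the same c governs the step
    -- upwards at i + 1 and the step downwards at j.
    eq₁ : c * b j ≡ + 4 * (P * + M) * b j - (P * + M - + suc i) * b (suc j)
    eq₁ = lemma (+ i) (+ j) (P * + M) (b j) (b (suc j)) j+2+i (b-suc j)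
      where
      lemma : ∀ I J Q x y → J + (+ 2 + I) ≡ Q → (1ℤ + J) * y ≡ + 2 * (+ 2 * J + 1ℤ) * x →
        + 2 * (+ 2 * (1ℤ + I) + 1ℤ) * x ≡ + 4 * Q * x - (Q - (1ℤ + I)) * y
      lemma I J _ x y refl e = trans
        (((∀ I J x → + 2 * (+ 2 * (1ℤ + I) + 1ℤ) * x ≡ + 4 * (J + (+ 2 + I)) * x - + 2 * (+ 2 * J + 1ℤ) * x) ∋ solve-∀) I J x)
        (trans (cong (λ z → + 4 * (J + (+ 2 + I)) * x - z) (sym e))
          (((∀ I J x y → + 4 * (J + (+ 2 + I)) * x - (1ℤ + J) * y ≡ + 4 * (J + (+ 2 + I)) * x - ((J + (+ 2 + I)) - (1ℤ + I)) * y) ∋ solve-∀) I J x y))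
    -- 2 (i + 1) + 1 < 2h + 1 = p by suc i < h; one step further this factor would be p itself.
    P∤c : ¬ P ∣ℤ c
    P∤c = P∤-* {+ 2} P∤2 (subst (λ z → ¬ P ∣ℤ z) (cong +_ shape)
      (P∤suc {suc (i ℕ.+ suc i)} (subst (_ ℕ.<_) (sym p≡1+2h) (s≤s (ℕ.+-mono-≤ i<h (ℕ.<⇒≤ i<h))))))
      where
      shape : suc (suc (i ℕ.+ suc i)) ≡ 2 ℕ.* suc i ℕ.+ 1
      shape = trans (ℕ.+-comm 1 (suc i ℕ.+ suc i)) (cong (λ z → suc i ℕ.+ z ℕ.+ 1) (sym (ℕ.+-identityʳ (suc i))))
    P∣bj : P ∣ℤ b j
    P∣bj = cancels-P c P∤c (∣-resp (sym eq₁)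
      (∣m∣n⇒∣m-n (∣m⇒∣m*n (b j) (∣n⇒∣m*n (+ 4) (∣m⇒∣m*n (+ M) ∣-refl))) (∣n⇒∣m*n (P * + M - + suc i) P∣bj₁)))

  -- A single term with index prime to p

  module _ {q n′ : ℤ} .{{_ : ℤ.NonZero q}} (cq : Cancels q) (P∤n′ : ¬ P ∣ℤ n′)
           (r m : ℕ) (n≡ : + suc (r ℕ.+ m) ≡ n′ * q) where

    private
      n : ℕ
      n = suc (r ℕ.+ m)
      N M R x : ℤ
      N = + n
      M = + suc m
      R = + r
      x = + ((r ℕ.+ m) C r)

      np≡ : n ℕ.* p ≡ r ℕ.* p ℕ.+ suc m ℕ.* p
      np≡ = trans (cong (ℕ._* p) (sym (ℕ.+-suc r m))) (ℕ.*-distribʳ-+ p r (suc m))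

      pos-np : + (n ℕ.* p) ≡ N * P
      pos-np = pos-* n p

    -- n C(n - 1, r) = (n - r) C(n, r), and likewise with all indices multiplied by p, so
    -- Jacobsthal's congruence carries over after a division by n. Working modulo P q leaves room
    -- for it: n′ is cancelled, then q is divided out.
    C[np-1]-base : ∀ o → suc (r ℕ.* p ℕ.+ o) ≡ n ℕ.* p → + ((r ℕ.* p ℕ.+ o) C (r ℕ.* p)) ≅ x [ P ]
    C[np-1]-base o eq = mod (*-cancelʳ-∣ q (∣-resp
        (((∀ a b c → a * c - b * c ≡ (a - b) * c) ∋ solve-∀) D₀ x q)
        (div (≅-cancel (cancels-* cq) n′ P∤n′ chain))))
      where
      D₀ y Y : ℤ
      D₀ = + ((r ℕ.* p ℕ.+ o) C (r ℕ.* p))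
      y = + ((r ℕ.+ suc m) C r)
      Y = + ((r ℕ.* p ℕ.+ suc m ℕ.* p) C (r ℕ.* p))
      My : M * y ≡ N * x
      My = trans (cong (λ z → M * + (z C r)) (ℕ.+-suc r m)) (C-absorbʳ r m)
      o≡ : suc o ≡ suc m ℕ.* p
      o≡ = ℕ.+-cancelˡ-≡ (r ℕ.* p) _ _ (trans (ℕ.+-suc (r ℕ.* p) o) (trans eq np≡))
      ND₀ : M * Y ≡ N * D₀
      ND₀ = *-cancelʳ-≡ (M * Y) (N * D₀) P (begin
        M * Y * P                           ≡⟨ ((∀ a b c → a * b * c ≡ a * c * b) ∋ solve-∀) M Y P ⟩
        M * P * Y                           ≡⟨ cong (_* Y) (trans (cong +_ o≡) (pos-* (suc m) p)) ⟨
        + suc o * Y                         ≡⟨ cong (λ z → + suc o * + (z C (r ℕ.* p))) (trans eq np≡) ⟨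
        + suc o * + (suc (r ℕ.* p ℕ.+ o) C (r ℕ.* p))  ≡⟨ C-absorbʳ (r ℕ.* p) o ⟩
        + suc (r ℕ.* p ℕ.+ o) * D₀          ≡⟨ cong (λ z → + z * D₀) eq ⟩
        + (n ℕ.* p) * D₀                    ≡⟨ cong (_* D₀) pos-np ⟩
        N * P * D₀                          ≡⟨ ((∀ a b c → a * b * c ≡ a * c * b) ∋ solve-∀) N P D₀ ⟩
        N * D₀ * P                          ∎)
        where open ≡-Reasoning
      q∣ : q ∣ℤ 1ℤ * y * M
      q∣ = ∣-resp (cong (_* M) (sym (*-identityˡ y)))
        (∣-trans (divides n′ (trans (cong +_ (ℕ.+-suc r m)) n≡)) (∣-absorbʳ r (suc m)))
      open ≅-Reasoning (P * q)
      chain : n′ * (D₀ * q) ≅ n′ * (x * q) [ P * q ]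
      chain = begin
        n′ * (D₀ * q)                     ≡⟨ ((∀ a b c → a * (b * c) ≡ a * c * b) ∋ solve-∀) n′ D₀ q ⟩
        n′ * q * D₀                       ≡⟨ cong (_* D₀) n≡ ⟨
        N * D₀                            ≡⟨ ND₀ ⟨
        M * Y                             ≡⟨ ((∀ M Y → M * Y ≡ M * (1ℤ * Y)) ∋ solve-∀) M Y ⟩
        M * (1ℤ * Y)
          ≈⟨ *-≅ˡ M (≅-weaken (divides (P * P) (((∀ P q → P * (P * (P * q)) ≡ P * P * (P * q)) ∋ solve-∀) P q))
               (C-shift cq 1ℤ r (suc m) q∣)) ⟩
        M * (1ℤ * (y * (1ℤ + P * P * (κ * (M * (R * (M + R)))))))
          ≡⟨ ((∀ M y P K e → M * (1ℤ * (y * (1ℤ + P * P * (K * (M * e)))))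
                ≡ M * y + P * P * K * e * M * (1ℤ * y * M)) ∋ solve-∀) M y P κ (R * (M + R)) ⟩
        M * y + P * P * κ * (R * (M + R)) * M * (1ℤ * y * M)
          ≡⟨ cong (λ z → M * y + P * P * κ * (R * (M + R)) * M * z) (_∣ℤ_.equality q∣) ⟩
        M * y + P * P * κ * (R * (M + R)) * M * (quotient q∣ * q)
          ≡⟨ ((∀ a P K b M k q → a + P * P * K * b * M * (k * q) ≡ a + P * K * b * M * k * (P * q)) ∋ solve-∀)
               (M * y) P κ (R * (M + R)) M (quotient q∣) q ⟩
        M * y + P * κ * (R * (M + R)) * M * quotient q∣ * (P * q)
          ≈⟨ +-multiple-≅ (M * y) (P * κ * (R * (M + R)) * M * quotient q∣) ⟩
        M * y                             ≡⟨ My ⟩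
        N * x                             ≡⟨ cong (_* x) n≡ ⟩
        n′ * q * x                        ≡⟨ ((∀ a b c → a * (b * c) ≡ a * c * b) ∋ solve-∀) n′ x q ⟨
        n′ * (x * q)                      ∎

    -- Neighbours in row np - 1 have the ratio (np - k)/k, which is -1 modulo p while k is prime to
    -- p.
    C[np-1] : ∀ i → i ℕ.< h → ∀ o → suc (r ℕ.* p ℕ.+ i ℕ.+ o) ≡ n ℕ.* p →
      + ((r ℕ.* p ℕ.+ i ℕ.+ o) C (r ℕ.* p ℕ.+ i)) ≅ -1ℤ ^ i * x [ P ]
    C[np-1] zero    _   o eq = ≅-trans (≅-reflexive (cong (λ z → + ((z ℕ.+ o) C z)) rp+0))
      (≅-trans (C[np-1]-base o (trans (cong (λ z → suc (z ℕ.+ o)) (sym rp+0)) eq)) (≅-reflexive (sym (*-identityˡ x))))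
      where
      rp+0 : r ℕ.* p ℕ.+ 0 ≡ r ℕ.* p
      rp+0 = ℕ.+-identityʳ (r ℕ.* p)
    C[np-1] (suc i) i<h o eq = ≅-cancel cancels-P (+ suc i) (P∤suc (ℕ.<-trans (ℕ.n<1+n (suc i)) (i<h⇒1+i<p i<h))) (begin
      + suc i * + ((r ℕ.* p ℕ.+ suc i ℕ.+ o) C (r ℕ.* p ℕ.+ suc i))
        ≡⟨ cong (λ z → + suc i * + ((z ℕ.+ o) C z)) (ℕ.+-suc (r ℕ.* p) i) ⟩
      + suc i * D₁
        ≈⟨ ≅-sym (+-multiple-≅ (+ suc i * D₁) (R * D₁)) ⟩
      + suc i * D₁ + R * D₁ * P
        ≡⟨ ((∀ I R D P → (1ℤ + I) * D + R * D * P ≡ (1ℤ + (R * P + I)) * D) ∋ solve-∀) (+ i) R D₁ P ⟩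
      (1ℤ + (R * P + + i)) * D₁
        ≡⟨ cong (λ z → (1ℤ + (z + + i)) * D₁) (pos-* r p) ⟨
      + suc k * D₁
        ≡⟨ C-step k o ⟩
      + suc o * D₀
        ≡⟨ cong (_* D₀) o≡ ⟩
      (N * P - R * P - + suc i) * D₀
        ≡⟨ ((∀ N P R s D → (N * P - R * P - s) * D ≡ s * (- D) + (N - R) * D * P) ∋ solve-∀) N P R (+ suc i) D₀ ⟩
      + suc i * - D₀ + (N - R) * D₀ * P
        ≈⟨ +-multiple-≅ (+ suc i * - D₀) ((N - R) * D₀) ⟩
      + suc i * - D₀
        ≈⟨ *-≅ˡ (+ suc i) (neg-≅ ih) ⟩
      + suc i * - (-1ℤ ^ i * x)
        ≡⟨ ((∀ s e x → s * - (e * x) ≡ s * (-1ℤ * e * x)) ∋ solve-∀) (+ suc i) (-1ℤ ^ i) x ⟩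
      + suc i * (-1ℤ ^ suc i * x) ∎)
      where
      open ≅-Reasoning P
      k : ℕ
      k = r ℕ.* p ℕ.+ i
      D₀ D₁ : ℤ
      D₀ = + (suc (k ℕ.+ o) C k)
      D₁ = + (suc (k ℕ.+ o) C suc k)
      eq′ : suc (suc (k ℕ.+ o)) ≡ n ℕ.* p
      eq′ = trans (cong (λ z → suc (z ℕ.+ o)) (sym (ℕ.+-suc (r ℕ.* p) i))) eq
      ih : D₀ ≅ -1ℤ ^ i * x [ P ]
      ih = ≅-trans (≅-reflexive (cong (λ z → + (z C k)) (sym (ℕ.+-suc k o))))
        (C[np-1] i (ℕ.<⇒≤ i<h) (suc o) (trans (cong suc (ℕ.+-suc k o)) eq′))
      o≡ : + suc o ≡ N * P - R * P - + suc i
      o≡ = trans (((∀ o I Q → 1ℤ + o ≡ (+ 2 + (Q + I + o)) - Q - (1ℤ + I)) ∋ solve-∀) (+ o) (+ i) (+ (r ℕ.* p)))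
        (cong₂ (λ y z → y - z - + suc i) (trans (cong +_ eq′) pos-np) (pos-* r p))

    module _ (i : ℕ) (i<h : i ℕ.< h) (j : ℕ) (eq : suc (r ℕ.* p ℕ.+ i ℕ.+ j) ≡ n ℕ.* p) where

      private
        k : ℕ
        k = suc (r ℕ.* p ℕ.+ i)
        s D₀ T W c : ℤ
        s = + suc i
        D₀ = + ((r ℕ.* p ℕ.+ i ℕ.+ j) C (r ℕ.* p ℕ.+ i))
        T = + ((n ℕ.* p) C k) * (b k * b j)
        W = D₀ * (b k * b j)
        c = -1ℤ ^ i * x * b r

        reflect = b-reflect (suc m) i i<h j (ℕ.+-cancelˡ-≡ (r ℕ.* p) _ _ (trans
          (trans (cong (r ℕ.* p ℕ.+_) (ℕ.+-suc j i)) (trans (ℕ.+-suc (r ℕ.* p) (j ℕ.+ i))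
            (cong suc (trans (cong (r ℕ.* p ℕ.+_) (ℕ.+-comm j i)) (sym (ℕ.+-assoc (r ℕ.* p) i j))))))
          (trans eq np≡)))

        K≡ : + k ≡ R * P + s
        K≡ = trans (((∀ Q I → 1ℤ + (Q + I) ≡ Q + (1ℤ + I)) ∋ solve-∀) (+ (r ℕ.* p)) (+ i)) (cong (_+ s) (pos-* r p))

        P∤s : ¬ P ∣ℤ s
        P∤s = P∤suc (i<h⇒1+i<p i<h)

        P∤k : ¬ P ∣ℤ + k
        P∤k d = P∤s (∣m+n∣m⇒∣n (∣-resp K≡ d) (∣-multiple R))

        kT : + k * T ≡ N * P * W
        kT = begin
          + k * (+ ((n ℕ.* p) C k) * (b k * b j))   ≡⟨ *-assoc (+ k) (+ ((n ℕ.* p) C k)) (b k * b j) ⟨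
          + k * + ((n ℕ.* p) C k) * (b k * b j)     ≡⟨ cong (λ z → + k * + (z C k) * (b k * b j)) eq ⟨
          + k * + (suc (r ℕ.* p ℕ.+ i ℕ.+ j) C k) * (b k * b j)
            ≡⟨ cong (_* (b k * b j)) (C-absorb (r ℕ.* p ℕ.+ i) j) ⟩
          + suc (r ℕ.* p ℕ.+ i ℕ.+ j) * D₀ * (b k * b j)
            ≡⟨ cong (λ z → z * D₀ * (b k * b j)) (trans (cong +_ eq) pos-np) ⟩
          N * P * D₀ * (b k * b j)                  ≡⟨ *-assoc (N * P) D₀ (b k * b j) ⟩
          N * P * W                                 ∎
          where open ≡-Reasoning

      -- Absorption gives k T = N P W with k prime to P, hence a factor P q; the second P comes from
      -- b(j).
      P²q∣summand : P * (P * q) ∣ℤ T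
      P²q∣summand = cancels-* (cancels-* cq) (+ k) P∤k (divides (n′ * D₀ * b k * quotient (proj₁ reflect)) (begin
        + k * T                       ≡⟨ kT ⟩
        N * P * (D₀ * (b k * b j))    ≡⟨ cong₂ (λ y z → y * P * (D₀ * (b k * z))) n≡ (_∣ℤ_.equality (proj₁ reflect)) ⟩
        n′ * q * P * (D₀ * (b k * (quotient (proj₁ reflect) * P)))
          ≡⟨ ((∀ n q P D b c → n * q * P * (D * (b * (c * P))) ≡ n * D * b * c * (P * (P * q))) ∋ solve-∀)
               n′ q P D₀ (b k) (quotient (proj₁ reflect)) ⟩
        n′ * D₀ * b k * quotient (proj₁ reflect) * (P * (P * q)) ∎))
        where open ≡-Reasoning

      sW : s * W ≅ - (c * (P * M * b (suc m))) [ P * P ]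
      sW = begin
        s * (D₀ * (b k * b j))
          ≡⟨ ((∀ s D y z → s * (D * (y * z)) ≡ D * y * (s * z)) ∋ solve-∀) s D₀ (b k) (b j) ⟩
        D₀ * b k * (s * b j)
          -- `s * b j` is divisible by P, so `D₀ * b k` is needed only modulo P.
          ≈⟨ *-≅-∣ (*-≅ (C[np-1] i i<h j eq) (≅-trans (≅-reflexive (cong b (sym (ℕ.+-suc (r ℕ.* p) i))))
               (b-lucas r (suc i) (i<h⇒1+i<p i<h)))) (∣n⇒∣m*n s (proj₁ reflect)) ⟩
        -1ℤ ^ i * x * (b r * b (suc i)) * (s * b j)
          ≡⟨ ((∀ a r y s z → a * (r * y) * (s * z) ≡ a * r * (s * y * z)) ∋ solve-∀) (-1ℤ ^ i * x) (b r) (b (suc i)) s (b j) ⟩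
        c * (s * b (suc i) * b j)
          ≈⟨ *-≅ˡ c (proj₂ reflect) ⟩
        c * - (P * M * b (suc m ℕ.* p))
          ≡⟨ ((∀ c P M y → c * - (P * M * y) ≡ - (c * M) * (y * P)) ∋ solve-∀) c P M (b (suc m ℕ.* p)) ⟩
        - (c * M) * (b (suc m ℕ.* p) * P)
          ≈⟨ *-≅ˡ (- (c * M)) (*-≅-∣ (b-p (suc m)) (∣-refl {P})) ⟩
        - (c * M) * (b (suc m) * P)
          ≡⟨ ((∀ c M y P → - (c * M) * (y * P) ≡ - (c * (P * M * y))) ∋ solve-∀) c M (b (suc m)) P ⟩
        - (c * (P * M * b (suc m))) ∎
        where open ≅-Reasoning (P * P)

      -- The factor N P obtained by absorption is a multiple of P q, so the rest, s W, is needed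
      -- only modulo P².
      summand : s * s * T ≅ N * P * P * -1ℤ ^ suc i * (x * (b r * (M * b (suc m)))) [ P * (P * (P * q)) ]
      summand = begin
        s * s * T
          -- One factor s becomes k = rp + s at the cost of a multiple of P T, which vanishes since
          -- P²q divides T.
          ≈⟨ ≅-sym (+-multiple′ P²q∣summand) ⟩
        s * s * T + s * R * T * P
          ≡⟨ ((∀ s T R P → s * s * T + s * R * T * P ≡ s * ((R * P + s) * T)) ∋ solve-∀) s T R P ⟩
        s * ((R * P + s) * T)
          ≡⟨ cong (λ z → s * (z * T)) K≡ ⟨
        s * (+ k * T)
          ≡⟨ cong (s *_) kT ⟩
        s * (N * P * W)
          ≡⟨ ((∀ s N P W → s * (N * P * W) ≡ s * W * (N * P)) ∋ solve-∀) s N P W ⟩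
        s * W * (N * P)
          ≈⟨ ≅-weaken PPNP (*-≅-∣ sW (∣-refl {N * P})) ⟩
        - (c * (P * M * b (suc m))) * (N * P)
          ≡⟨ ((∀ e x r P M y N → - (e * x * r * (P * M * y)) * (N * P) ≡ N * P * P * (-1ℤ * e) * (x * (r * (M * y)))) ∋ solve-∀)
               (-1ℤ ^ i) x (b r) P M (b (suc m)) N ⟩
        N * P * P * -1ℤ ^ suc i * (x * (b r * (M * b (suc m)))) ∎
        where
        open ≅-Reasoning (P * (P * (P * q)))
        PPNP : P * (P * (P * q)) ∣ℤ P * P * (N * P)
        PPNP = divides n′ (trans (cong (λ z → P * P * (z * P)) n≡)
          (((∀ P n q → P * P * (n * q * P) ≡ n * (P * (P * (P * q)))) ∋ solve-∀) P n′ q))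
        +-multiple′ : P * (P * q) ∣ℤ T → s * s * T + s * R * T * P ≅ s * s * T [ P * (P * (P * q)) ]
        +-multiple′ (divides t T≡) = ≅-trans
          (≅-reflexive (cong (λ z → s * s * T + z) (trans (cong (λ z → s * R * z * P) T≡)
            (((∀ s R t P q → s * R * (t * (P * (P * q))) * P ≡ s * R * t * (P * (P * (P * q)))) ∋ solve-∀) s R t P q))))
          (+-multiple-≅ (s * s * T) (s * R * t))

  -- Summing the terms of S(np)

  τ : ℤ
  τ = ∑< h (λ i → -1ℤ ^ suc i * (+ suc i) ^ (l ℕ.+ l))

  module Main {q n′ : ℤ} .{{_ : ℤ.NonZero q}} (cq : Cancels q) (P∤n′ : ¬ P ∣ℤ n′)
              (n₁ : ℕ) (n≡ : + suc n₁ ≡ n′ * q) where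

    n : ℕ
    n = suc n₁

    N : ℤ
    N = + n

    S : Seq
    S = b ⋆ b

    t : ℕ → ℤ
    t k = + ((n ℕ.* p) C k) * (b k * b (n ℕ.* p ∸ k))

    t-sym : ∀ k j → k ℕ.+ j ≡ n ℕ.* p → t k ≡ t j
    t-sym k j eq = cong₂ _*_
      (cong +_ (trans (nCk≡nC[n∸k] (subst (k ℕ.≤_) eq (ℕ.m≤m+n k j))) (cong ((n ℕ.* p) C_) ∸k≡j)))
      (trans (cong₂ (λ y z → b y * b z) (sym ∸j≡k) ∸k≡j) (*-comm (b (n ℕ.* p ∸ j)) (b j)))
      where
      ∸k≡j : n ℕ.* p ∸ k ≡ j
      ∸k≡j = trans (cong (_∸ k) (sym eq)) (ℕ.m+n∸m≡n k j)
      ∸j≡k : n ℕ.* p ∸ j ≡ k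
      ∸j≡k = trans (cong (_∸ j) (sym eq)) (ℕ.m+n∸n≡m k j)

    ∑-multiples : ∑< (suc n) (λ r → t (r ℕ.* p))
      ≅ S n + P * P * (κ * (N * (+ 2 * (N * N) * S n - + 5 * Q n))) [ P * (P * (P * q)) ]
    ∑-multiples = begin
      ∑< (suc n) (λ r → t (r ℕ.* p))
        ≈⟨ ∑-≅ (suc n) (λ { r (s≤s r≤n) → each r (n ∸ r) (ℕ.m+[n∸m]≡n r≤n) }) ⟩
      ∑< (suc n) (λ r → A * f r (n ∸ r) + B * g′ r (n ∸ r))
        ≡⟨ ∑-+ (suc n) (λ r → A * f r (n ∸ r)) (λ r → B * g′ r (n ∸ r)) ⟨
      ∑< (suc n) (λ r → A * f r (n ∸ r)) + ∑< (suc n) (λ r → B * g′ r (n ∸ r))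
        ≡⟨ cong₂ _+_ (∑-*ˡ (suc n) A _) (∑-*ˡ (suc n) B _) ⟨
      A * ∑< (suc n) (λ r → f r (n ∸ r)) + B * ∑< (suc n) (λ r → g′ r (n ∸ r))
        ≡⟨ cong₂ (λ y z → A * y + B * z) (⋆-∑ b b n) (⋆-∑ (θ b) (θ b) n) ⟨
      A * S n + B * Q n
        ≡⟨ ((∀ P K N S Q → (1ℤ + P * P * (K * (N * (+ 2 * (N * N))))) * S + (- (P * P * (K * (N * + 5)))) * Q
               ≡ S + P * P * (K * (N * (+ 2 * (N * N) * S - + 5 * Q)))) ∋ solve-∀) P κ N (S n) (Q n) ⟩
      S n + P * P * (κ * (N * (+ 2 * (N * N) * S n - + 5 * Q n))) ∎
      where
      open ≅-Reasoning (P * (P * (P * q)))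
      A B : ℤ
      A = 1ℤ + P * P * (κ * (N * (+ 2 * (N * N))))
      B = - (P * P * (κ * (N * + 5)))
      f g′ : ℕ → ℕ → ℤ
      f r m = + (n C r) * (b r * b m)
      g′ r m = + (n C r) * (θ b r * θ b m)
      each : ∀ r m → r ℕ.+ m ≡ n → t (r ℕ.* p) ≅ A * f r m + B * g′ r m [ P * (P * (P * q)) ]
      each r m r+m≡n = begin
        t (r ℕ.* p)
          ≡⟨ cong₂ (λ y z → + (y C (r ℕ.* p)) * (b (r ℕ.* p) * b z)) np≡
               (trans (cong (_∸ r ℕ.* p) np≡) (ℕ.m+n∸m≡n (r ℕ.* p) (m ℕ.* p))) ⟩
        + ((r ℕ.* p ℕ.+ m ℕ.* p) C (r ℕ.* p)) * (b (r ℕ.* p) * b (m ℕ.* p))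
          ≈⟨ multiple-block cq r m (divides n′ (trans (cong +_ r+m≡n) n≡)) ⟩
        + ((r ℕ.+ m) C r) * (b r * b m) * G (+ r + + m)
          ≡⟨ cong (λ z → + (z C r) * (b r * b m) * G (+ z)) r+m≡n ⟩
        + (n C r) * (b r * b m) * G N
          -- The error depends on r only through r m = r (n - r): the constant part will sum to
          -- S(n), and r b(r) · m b(m) to Q(n).
          ≡⟨ ((∀ c x y P K N R M → c * (x * y) * (1ℤ + P * P * (K * (N * (+ 2 * (N * N) - + 5 * (R * M)))))
                ≡ (1ℤ + P * P * (K * (N * (+ 2 * (N * N))))) * (c * (x * y))
                  + (- (P * P * (K * (N * + 5)))) * (c * (R * x * (M * y)))) ∋ solve-∀)
               (+ (n C r)) (b r) (b m) P κ N (+ r) (+ m) ⟩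
        A * f r m + B * g′ r m ∎
        where
        G : ℤ → ℤ
        G N = 1ℤ + P * P * (κ * (N * (+ 2 * (N * N) - + 5 * (+ r * + m))))
        np≡ : n ℕ.* p ≡ r ℕ.* p ℕ.+ m ℕ.* p
        np≡ = trans (cong (ℕ._* p) (sym r+m≡n)) (ℕ.*-distribʳ-+ p r m)

    module _ (i : ℕ) (i<h : i ℕ.< h) where

      private
        s e : ℤ
        s = + suc i
        e = -1ℤ ^ suc i

      nonmultiple : ∀ r m → r ℕ.+ m ≡ n₁ → s * s * t (r ℕ.* p ℕ.+ suc i)
        ≅ N * P * P * e * (+ (n₁ C r) * (b r * D (θ b) m)) [ P * (P * (P * q)) ]
      nonmultiple r m refl = ≅-trans
        (≅-reflexive (cong (λ z → s * s * t z) (ℕ.+-suc (r ℕ.* p) i)))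
        (summand cq P∤n′ r m n≡ i i<h (n ℕ.* p ∸ suc (r ℕ.* p ℕ.+ i)) (ℕ.m+[n∸m]≡n k≤np))
        where
        k≤np : suc (r ℕ.* p ℕ.+ i) ℕ.≤ n ℕ.* p
        k≤np = begin
          suc (r ℕ.* p ℕ.+ i)     ≡⟨ ℕ.+-suc (r ℕ.* p) i ⟨
          r ℕ.* p ℕ.+ suc i       ≤⟨ ℕ.+-monoʳ-≤ (r ℕ.* p) (ℕ.<⇒≤ (i<h⇒1+i<p i<h)) ⟩
          r ℕ.* p ℕ.+ p           ≡⟨ ℕ.+-comm (r ℕ.* p) p ⟩
          suc r ℕ.* p             ≤⟨ ℕ.*-monoˡ-≤ p (s≤s (ℕ.m≤m+n r m)) ⟩
          n ℕ.* p                 ∎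
          where open ℕ.≤-Reasoning

      ∑-residue : ∑< n (λ r → t (r ℕ.* p ℕ.+ suc i))
        ≅ + 2 * N * N * P * P * S n₁ * (e * s ^ (l ℕ.+ l)) [ P * (P * (P * q)) ]
      ∑-residue = ≅-cancel (cancels-* (cancels-* (cancels-* cq))) (s * s) (P∤-* {s} {s} P∤s P∤s) (begin
        s * s * ∑< n (λ r → t (r ℕ.* p ℕ.+ suc i))
          ≡⟨ ∑-*ˡ n (s * s) (λ r → t (r ℕ.* p ℕ.+ suc i)) ⟩
        ∑< n (λ r → s * s * t (r ℕ.* p ℕ.+ suc i))
          ≈⟨ ∑-≅ n (λ { r (s≤s r≤n₁) → nonmultiple r (n₁ ∸ r) (ℕ.m+[n∸m]≡n r≤n₁) }) ⟩
        ∑< n (λ r → N * P * P * e * (+ (n₁ C r) * (b r * D (θ b) (n₁ ∸ r))))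
          ≡⟨ ∑-*ˡ n (N * P * P * e) (λ r → + (n₁ C r) * (b r * D (θ b) (n₁ ∸ r))) ⟨
        N * P * P * e * ∑< n (λ r → + (n₁ C r) * (b r * D (θ b) (n₁ ∸ r)))
          -- (n - r) b(n - r) is D (θ b) at n₁ - r, so the sum over r is the convolution already
          -- evaluated for the recurrence.
          ≡⟨ cong (N * P * P * e *_) (trans (sym (⋆-∑ b (D (θ b)) n₁)) (b⋆Dθb n₁)) ⟩
        N * P * P * e * (+ 2 * N * S n₁)
          ≡⟨ ((∀ N P e S → N * P * P * e * (+ 2 * N * S) ≡ 1ℤ * (+ 2 * N * P * S * e * (P * N))) ∋ solve-∀) N P e (S n₁) ⟩
        1ℤ * (+ 2 * N * P * S n₁ * e * (P * N))
          -- s² s^(p-3) ≡ 1 holds only modulo P; the cofactor, a multiple of P² N, raises the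
          -- modulus.
          ≈⟨ ≅-weaken P³q∣ (*-≅-∣ (≅-sym (fermat-inverse (i<h⇒1+i<p i<h))) PPN∣) ⟩
        s * s * s ^ (l ℕ.+ l) * (+ 2 * N * P * S n₁ * e * (P * N))
          ≡⟨ ((∀ s y N P S e → s * s * y * (+ 2 * N * P * S * e * (P * N)) ≡ s * s * (+ 2 * N * N * P * P * S * (e * y))) ∋ solve-∀)
               s (s ^ (l ℕ.+ l)) N P (S n₁) e ⟩
        s * s * (+ 2 * N * N * P * P * S n₁ * (e * s ^ (l ℕ.+ l))) ∎)
        where
        open ≅-Reasoning (P * (P * (P * q)))
        P∤s : ¬ P ∣ℤ s
        P∤s = P∤suc (i<h⇒1+i<p i<h)
        PPN∣ : P * P * N ∣ℤ + 2 * N * P * S n₁ * e * (P * N)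
        PPN∣ = divides (+ 2 * N * S n₁ * e)
          (((∀ N P S e → + 2 * N * P * S * e * (P * N) ≡ + 2 * N * S * e * (P * P * N)) ∋ solve-∀) N P (S n₁) e)
        P³q∣ : P * (P * (P * q)) ∣ℤ P * (P * P * N)
        P³q∣ = divides n′ (trans (cong (λ z → P * (P * P * z)) n≡)
          (((∀ P n q → P * (P * P * (n * q)) ≡ n * (P * (P * (P * q)))) ∋ solve-∀) P n′ q))

    ∑-nonmultiples : ∑< h (λ i → ∑< n (λ r → t (r ℕ.* p ℕ.+ suc i)))
      ≅ + 2 * N * N * P * P * S n₁ * τ [ P * (P * (P * q)) ]
    ∑-nonmultiples = ≅-trans (∑-≅ h ∑-residue)
      (≅-reflexive (sym (∑-*ˡ h (+ 2 * N * N * P * P * S n₁) (λ i → -1ℤ ^ suc i * (+ suc i) ^ (l ℕ.+ l)))))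

    -- A block of p indices consists of a multiple of p, a lower and an upper half. The reflection k
    -- ↦ np - k takes the upper half of block n - 1 - r to the lower half of block r.
    split : S (n ℕ.* p) ≡ ∑< (suc n) (λ r → t (r ℕ.* p))
      + + 2 * ∑< h (λ i → ∑< n (λ r → t (r ℕ.* p ℕ.+ suc i)))
    split = begin
      S (n ℕ.* p)
        ≡⟨ ⋆-∑ b b (n ℕ.* p) ⟩
      ∑< (n ℕ.* p) t + t (n ℕ.* p)
        ≡⟨ cong (_+ t (n ℕ.* p)) (∑-blocks n p t) ⟩
      ∑< n (λ r → ∑< p (λ i → t (r ℕ.* p ℕ.+ i))) + t (n ℕ.* p)
        ≡⟨ cong (_+ t (n ℕ.* p)) (trans (∑-cong n (λ r _ → block r))
             (trans (sym (∑-+ n (λ r → t (r ℕ.* p) + low r) high)) (cong (_+ ∑< n high) (sym (∑-+ n (λ r → t (r ℕ.* p)) low))))) ⟩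
      ∑< n (λ r → t (r ℕ.* p)) + ∑< n low + ∑< n high + t (n ℕ.* p)
        ≡⟨ cong (λ z → ∑< n (λ r → t (r ℕ.* p)) + ∑< n low + z + t (n ℕ.* p)) high≡low ⟩
      ∑< n (λ r → t (r ℕ.* p)) + ∑< n low + ∑< n low + t (n ℕ.* p)
        ≡⟨ ((∀ a l t → a + l + l + t ≡ a + t + + 2 * l) ∋ solve-∀) (∑< n (λ r → t (r ℕ.* p))) (∑< n low) (t (n ℕ.* p)) ⟩
      ∑< (suc n) (λ r → t (r ℕ.* p)) + + 2 * ∑< n low
        ≡⟨ cong (λ z → ∑< (suc n) (λ r → t (r ℕ.* p)) + + 2 * z) (∑-swap n h (λ r i → t (r ℕ.* p ℕ.+ suc i))) ⟩
      ∑< (suc n) (λ r → t (r ℕ.* p)) + + 2 * ∑< h (λ i → ∑< n (λ r → t (r ℕ.* p ℕ.+ suc i))) ∎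
      where
      open ≡-Reasoning
      low high : ℕ → ℤ
      low  r = ∑< h (λ i → t (r ℕ.* p ℕ.+ suc i))
      high r = ∑< h (λ i → t (r ℕ.* p ℕ.+ suc (h ℕ.+ (h ∸ suc i))))
      block : ∀ r → ∑< p (λ i → t (r ℕ.* p ℕ.+ i)) ≡ t (r ℕ.* p) + low r + high r
      block r = begin
        ∑< p (λ i → t (r ℕ.* p ℕ.+ i))
          ≡⟨ cong (λ z → ∑< z (λ i → t (r ℕ.* p ℕ.+ i))) p≡1+2h ⟩
        ∑< (suc (h ℕ.+ h)) (λ i → t (r ℕ.* p ℕ.+ i))
          ≡⟨ ∑-first (h ℕ.+ h) (λ i → t (r ℕ.* p ℕ.+ i)) ⟩
        t (r ℕ.* p ℕ.+ 0) + ∑< (h ℕ.+ h) (λ i → t (r ℕ.* p ℕ.+ suc i))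
          ≡⟨ cong₂ _+_ (cong t (ℕ.+-identityʳ (r ℕ.* p))) (trans (∑-append h h (λ i → t (r ℕ.* p ℕ.+ suc i)))
               (cong₂ _+_ {x = low r} refl (∑-reverse h (λ i → t (r ℕ.* p ℕ.+ suc (h ℕ.+ i)))))) ⟩
        t (r ℕ.* p) + (low r + high r)
          ≡⟨ +-assoc (t (r ℕ.* p)) (low r) (high r) ⟨
        t (r ℕ.* p) + low r + high r ∎
      high≡low : ∑< n high ≡ ∑< n low
      high≡low = trans (∑-reverse n high) (∑-cong n λ r r<n → ∑-cong h λ i i<h →
        t-sym ((n ∸ suc r) ℕ.* p ℕ.+ suc (h ℕ.+ (h ∸ suc i))) (r ℕ.* p ℕ.+ suc i) (index r i r<n i<h))
        where
        index : ∀ r i → r ℕ.< n → i ℕ.< h →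
          (n ∸ suc r) ℕ.* p ℕ.+ suc (h ℕ.+ (h ∸ suc i)) ℕ.+ (r ℕ.* p ℕ.+ suc i) ≡ n ℕ.* p
        index r i r<n i<h = begin
          (n ∸ suc r) ℕ.* p ℕ.+ suc (h ℕ.+ (h ∸ suc i)) ℕ.+ (r ℕ.* p ℕ.+ suc i)
            ≡⟨ cong ((n ∸ suc r) ℕ.* p ℕ.+ suc (h ℕ.+ (h ∸ suc i)) ℕ.+_) (ℕ.+-comm (r ℕ.* p) (suc i)) ⟩
          (n ∸ suc r) ℕ.* p ℕ.+ suc (h ℕ.+ (h ∸ suc i)) ℕ.+ (suc i ℕ.+ r ℕ.* p)
            ≡⟨ ℕ.+-assoc ((n ∸ suc r) ℕ.* p ℕ.+ suc (h ℕ.+ (h ∸ suc i))) (suc i) (r ℕ.* p) ⟨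
          (n ∸ suc r) ℕ.* p ℕ.+ suc (h ℕ.+ (h ∸ suc i)) ℕ.+ suc i ℕ.+ r ℕ.* p
            ≡⟨ cong (ℕ._+ r ℕ.* p) (ℕ.+-assoc ((n ∸ suc r) ℕ.* p) (suc (h ℕ.+ (h ∸ suc i))) (suc i)) ⟩
          (n ∸ suc r) ℕ.* p ℕ.+ suc (h ℕ.+ (h ∸ suc i) ℕ.+ suc i) ℕ.+ r ℕ.* p
            ≡⟨ cong (λ z → (n ∸ suc r) ℕ.* p ℕ.+ suc z ℕ.+ r ℕ.* p)
                 (trans (ℕ.+-assoc h (h ∸ suc i) (suc i)) (cong (h ℕ.+_) (ℕ.m∸n+n≡m i<h))) ⟩
          (n ∸ suc r) ℕ.* p ℕ.+ suc (h ℕ.+ h) ℕ.+ r ℕ.* p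
            ≡⟨ cong (λ z → (n ∸ suc r) ℕ.* p ℕ.+ z ℕ.+ r ℕ.* p) (sym p≡1+2h) ⟩
          (n ∸ suc r) ℕ.* p ℕ.+ p ℕ.+ r ℕ.* p
            ≡⟨ ℕ.+-assoc ((n ∸ suc r) ℕ.* p) p (r ℕ.* p) ⟩
          (n ∸ suc r) ℕ.* p ℕ.+ suc r ℕ.* p
            ≡⟨ ℕ.*-distribʳ-+ p (n ∸ suc r) (suc r) ⟨
          (n ∸ suc r ℕ.+ suc r) ℕ.* p
            ≡⟨ cong (ℕ._* p) (ℕ.m∸n+n≡m r<n) ⟩
          n ℕ.* p ∎

    S[np]≅ : S (n ℕ.* p) ≅ S n + P * P * (κ * (N * (+ 2 * (N * N) * S n - + 5 * Q n)))
      + + 4 * N * N * P * P * S n₁ * τ [ P * (P * (P * q)) ]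
    S[np]≅ = begin
      S (n ℕ.* p)
        ≡⟨ split ⟩
      ∑< (suc n) (λ r → t (r ℕ.* p)) + + 2 * ∑< h (λ i → ∑< n (λ r → t (r ℕ.* p ℕ.+ suc i)))
        ≈⟨ +-≅ ∑-multiples (*-≅ˡ (+ 2) ∑-nonmultiples) ⟩
      I + + 2 * (+ 2 * N * N * P * P * S n₁ * τ)
        ≡⟨ ((∀ a N P S t → a + + 2 * (+ 2 * N * N * P * P * S * t) ≡ a + + 4 * N * N * P * P * S * t) ∋ solve-∀)
             I N P (S n₁) τ ⟩
      I + + 4 * N * N * P * P * S n₁ * τ ∎
      where
      open ≅-Reasoning (P * (P * (P * q)))
      I : ℤ
      I = S n + P * P * (κ * (N * (+ 2 * (N * N) * S n - + 5 * Q n)))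

  -- Power sums modulo p

  4*2^[p-3] : + 4 * (+ 2) ^ (l ℕ.+ l) ≅ 1ℤ [ P ]
  4*2^[p-3] = fermat-inverse (subst (2 ℕ.<_) (sym p≡3+2l) (s≤s (s≤s (s≤s z≤n))))

  double-^ : ∀ s → (+ s + + s) ^ (l ℕ.+ l) ≡ (+ 2) ^ (l ℕ.+ l) * (+ s) ^ (l ℕ.+ l)
  double-^ s = trans (cong (_^ (l ℕ.+ l)) (((∀ s → s + s ≡ + 2 * s) ∋ solve-∀) (+ s))) (*-^ (+ 2) (+ s) (l ℕ.+ l))

  -- Multiplying by 4 · 2^(p-3) ≡ 1 turns s^(p-3) into (2s)^(p-3), the form that `telescope` sums.
  -- For l > 0 the lower end W 1 vanishes at p - 3.
  τ≅E : ∀ {E} → IsEuler E → .{{_ : NonZero l}} → τ ≅ + 2 * (-1ℤ ^ h * E (l ℕ.+ l)) [ P ]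
  τ≅E {E} isEuler = begin
    τ                                       ≡⟨ *-identityˡ τ ⟨
    1ℤ * τ                                  ≈⟨ *-≅ (≅-sym 4*2^[p-3]) (≅-refl {a = τ}) ⟩
    + 4 * t * τ                             ≡⟨ ((∀ t τ → + 4 * t * τ ≡ + 2 * (+ 2 * t * τ)) ∋ solve-∀) t τ ⟩
    + 2 * (+ 2 * t * τ)
      ≡⟨ cong (+ 2 *_) (trans (∑-*ˡ h (+ 2 * t) (λ i → -1ℤ ^ suc i * (+ suc i) ^ (l ℕ.+ l)))
           (∑-cong h λ i _ → trans
             (((∀ t e y → + 2 * t * (e * y) ≡ e * (+ 2 * (t * y))) ∋ solve-∀) t (-1ℤ ^ suc i) ((+ suc i) ^ (l ℕ.+ l)))
             (cong (λ z → -1ℤ ^ suc i * (+ 2 * z)) (sym (double-^ (suc i)))))) ⟩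
    + 2 * ∑< h (λ i → -1ℤ ^ suc i * (+ 2 * (+ suc i + + suc i) ^ (l ℕ.+ l)))
      ≡⟨ cong (+ 2 *_) (telescope (l ℕ.+ l) h) ⟩
    + 2 * (-1ℤ ^ h * W (+ suc (h ℕ.+ h)) (l ℕ.+ l) - W 1ℤ (l ℕ.+ l))
      ≡⟨ cong₂ (λ y z → + 2 * (-1ℤ ^ h * W y (l ℕ.+ l) - z)) (cong +_ (sym p≡1+2h)) (W1-even l) ⟩
    + 2 * (-1ℤ ^ h * W P (l ℕ.+ l) - 0ℤ)
      ≡⟨ ((∀ x → + 2 * (x - 0ℤ) ≡ + 2 * x) ∋ solve-∀) (-1ℤ ^ h * W P (l ℕ.+ l)) ⟩
    + 2 * (-1ℤ ^ h * W P (l ℕ.+ l))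
      -- The upper end 2h + 1 = p may be replaced by 0, where W is the Euler number itself.
      ≈⟨ *-≅ˡ (+ 2) (*-≅ˡ (-1ℤ ^ h) (W-≅ (l ℕ.+ l) (≅0 (∣-refl {P})))) ⟩
    + 2 * (-1ℤ ^ h * W 0ℤ (l ℕ.+ l))
      ≡⟨ cong (λ z → + 2 * (-1ℤ ^ h * z)) (⋆-identityʳ E (l ℕ.+ l)) ⟩
    + 2 * (-1ℤ ^ h * E (l ℕ.+ l)) ∎
    where
    open Euler E isEuler
    open ≅-Reasoning P
    t : ℤ
    t = (+ 2) ^ (l ℕ.+ l)

  private
    f : ℕ → ℤ
    f s = (+ s) ^ (l ℕ.+ l)

  f-reflect : ∀ s s′ → s ℕ.+ s′ ≡ p → f s ≅ f s′ [ P ]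
  f-reflect s s′ eq = ≅-trans (^-≅ {a = + s} { - + s′} (l ℕ.+ l) (≅-from
      (trans (cong +_ (sym eq)) (((∀ s t → s + t ≡ s - - t) ∋ solve-∀) (+ s) (+ s′))) (∣-refl {P})))
    (≅-reflexive (neg-^-double (+ s′) l))

  -- With H = ∑_{s ≤ h} s^(p-3), reflecting s ↦ p - s gives ∑_{s < p} s^(p-3) = 2 H, while
  -- sorting by parity and reflecting the odd terms gives 2 ∑_{s ≤ h} (2s)^(p-3) = 2 2^(p-3) H.
  P∣half-sum : 3 ℕ.< p → P ∣ℤ ∑< h (f ∘ suc)
  P∣half-sum 3<p = cancels-P (+ 6) P∤6 (∣-resp (neg-involutive (+ 6 * H′)) (∣m⇒∣-m (∣-resp (*-neg (H′))
      (div (begin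
        + 2 * H′
          ≡⟨ ((∀ x → + 2 * x ≡ 1ℤ * (+ 2 * x)) ∋ solve-∀) H′ ⟩
        1ℤ * (+ 2 * H′)
          -- This factor absorbs the 2^(p-3) of the parity evaluation. The outcome 2H ≡ 8H gives P ∣
          -- 6H, and p > 3 is prime to 6.
          ≈⟨ *-≅ (≅-sym 4*2^[p-3]) ≅-refl ⟩
        + 4 * t * (+ 2 * H′)
          ≡⟨ ((∀ t x → + 4 * t * (+ 2 * x) ≡ + 4 * (+ 2 * (t * x))) ∋ solve-∀) t H′ ⟩
        + 4 * (+ 2 * (t * H′))
          ≈⟨ *-≅ˡ (+ 4) (≅-trans (≅-sym by-parity) by-halves) ⟩
        + 4 * (+ 2 * H′) ∎)))))
    where
    open ≅-Reasoning P
    H′ t : ℤ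
    H′ = ∑< h (f ∘ suc)
    t = (+ 2) ^ (l ℕ.+ l)
    *-neg : ∀ x → + 2 * x - + 4 * (+ 2 * x) ≡ - (+ 6 * x)
    *-neg = solve-∀
    P∤6 : ¬ P ∣ℤ + 6
    P∤6 = P∤-* {+ 2} {+ 3} P∤2 (P∤suc 3<p)
    by-halves : ∑< (h ℕ.+ h) (f ∘ suc) ≅ + 2 * H′ [ P ]
    by-halves = begin
      ∑< (h ℕ.+ h) (f ∘ suc)                                      ≡⟨ ∑-append h h (f ∘ suc) ⟩
      H′ + ∑< h (λ i → f (suc (h ℕ.+ i)))                         ≡⟨ cong (λ z → H′ + z) (∑-reverse h (λ i → f (suc (h ℕ.+ i)))) ⟩
      H′ + ∑< h (λ i → f (suc (h ℕ.+ (h ∸ suc i))))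
        ≈⟨ +-≅ (≅-refl {a = H′}) (∑-≅ h λ i i<h → f-reflect (suc (h ℕ.+ (h ∸ suc i))) (suc i)
             (trans (cong suc (trans (ℕ.+-assoc h (h ∸ suc i) (suc i)) (cong (h ℕ.+_) (ℕ.m∸n+n≡m i<h)))) (sym p≡1+2h))) ⟩
      H′ + H′                                                     ≡⟨ ((∀ x → x + x ≡ + 2 * x) ∋ solve-∀) H′ ⟩
      + 2 * H′ ∎
    evens : ∑< h (λ i → f (suc i ℕ.+ suc i)) ≡ t * H′
    evens = trans (∑-cong h λ i _ → double-^ (suc i)) (sym (∑-*ˡ h t (f ∘ suc)))
    by-parity : ∑< (h ℕ.+ h) (f ∘ suc) ≅ + 2 * (t * H′) [ P ]
    by-parity = begin
      ∑< (h ℕ.+ h) (f ∘ suc)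
        ≡⟨ ∑-pairs h (f ∘ suc) ⟩
      ∑< h (λ i → f (suc (i ℕ.+ i)) + f (suc (suc (i ℕ.+ i))))
        ≡⟨ ∑-+ h (λ i → f (suc (i ℕ.+ i))) (λ i → f (suc (suc (i ℕ.+ i)))) ⟨
      ∑< h (λ i → f (suc (i ℕ.+ i))) + ∑< h (λ i → f (suc (suc (i ℕ.+ i))))
        ≡⟨ cong₂ _+_ (∑-reverse h (λ i → f (suc (i ℕ.+ i))))
             (∑-cong h λ i _ → cong (f ∘ suc) (sym (ℕ.+-suc i i))) ⟩
      ∑< h (λ i → f (suc ((h ∸ suc i) ℕ.+ (h ∸ suc i)))) + ∑< h (λ i → f (suc i ℕ.+ suc i))
        ≈⟨ +-≅ (∑-≅ h λ i i<h → f-reflect (suc ((h ∸ suc i) ℕ.+ (h ∸ suc i))) (suc i ℕ.+ suc i) (odd i i<h)) ≅-refl ⟩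
      ∑< h (λ i → f (suc i ℕ.+ suc i)) + ∑< h (λ i → f (suc i ℕ.+ suc i))
        ≡⟨ cong₂ _+_ evens evens ⟩
      t * H′ + t * H′
        ≡⟨ ((∀ x → x + x ≡ + 2 * x) ∋ solve-∀) (t * H′) ⟩
      + 2 * (t * H′) ∎
      where
      odd : ∀ i → i ℕ.< h → suc ((h ∸ suc i) ℕ.+ (h ∸ suc i)) ℕ.+ (suc i ℕ.+ suc i) ≡ p
      odd i i<h = trans (cong suc (trans (interchange (h ∸ suc i) (h ∸ suc i) (suc i) (suc i))
          (cong₂ ℕ._+_ (ℕ.m∸n+n≡m i<h) (ℕ.m∸n+n≡m i<h)))) (sym p≡1+2h)
        where open import Algebra.Properties.CommutativeSemigroup ℕ.+-commutativeSemigroup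

  P∣κ : 3 ℕ.< p → P ∣ℤ κ
  P∣κ 3<p = ∣-resp (trans (((∀ x → - x ≡ -1ℤ * x) ∋ solve-∀) (∑< h (f ∘ suc)))
      (trans (∑-*ˡ h -1ℤ (f ∘ suc)) (∑-cong h λ i _ → ((∀ x → -1ℤ * x ≡ - x) ∋ solve-∀) (f (suc i)))))
    (∣m⇒∣-m (P∣half-sum 3<p))

  -- The three cases

  congruence-p>3 : ∀ {E} → IsEuler E → p > 3 → ∀ n₁ → p ∤ suc n₁ →
    (b ⋆ b) (suc n₁ ℕ.* p) - (b ⋆ b) (suc n₁)
      ≅ + 8 * (+ suc n₁) ^ 2 * (b ⋆ b) n₁ * -1ℤ ^ ((p ∸ 1) / 2) * P ^ 2 * E (p ∸ 3) [ P ^ 3 ]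
  congruence-p>3 {E} isEuler 3<p n₁ p∤n = begin
    S (suc n₁ ℕ.* p) - S (suc n₁)
      ≈⟨ +-≅ S[np]≅ (≅-refl {a = - S (suc n₁)}) ⟩
    S (suc n₁) + P * P * (κ * Y) + + 4 * N * N * P * P * S n₁ * τ - S (suc n₁)
      ≡⟨ ((∀ s P K Y N S T → s + P * P * (K * Y) + + 4 * N * N * P * P * S * T - s
            ≡ K * (P * P) * Y + T * (P * P) * (+ 4 * N * N * S)) ∋ solve-∀) (S (suc n₁)) P κ Y N (S n₁) τ ⟩
    κ * (P * P) * Y + τ * (P * P) * (+ 4 * N * N * S n₁)
      -- P² is already a factor, so the vanishing of κ and the Euler value of τ are needed only
      -- modulo P.
      ≈⟨ +-≅ (*-≅ (κPP (≅0 (P∣κ 3<p))) (≅-refl {a = Y})) (*-≅ (κPP (τ≅E isEuler)) (≅-refl {a = + 4 * N * N * S n₁})) ⟩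
    0ℤ * (P * P) * Y + + 2 * (-1ℤ ^ h * E (l ℕ.+ l)) * (P * P) * (+ 4 * N * N * S n₁)
      ≡⟨ ((∀ P Y e E N S → 0ℤ * (P * P) * Y + + 2 * (e * E) * (P * P) * (+ 4 * N * N * S)
            ≡ + 8 * (N * (N * 1ℤ)) * S * e * (P * (P * 1ℤ)) * E) ∋ solve-∀)
           P Y (-1ℤ ^ h) (E (l ℕ.+ l)) N (S n₁) ⟩
    + 8 * N ^ 2 * S n₁ * -1ℤ ^ h * P ^ 2 * E (l ℕ.+ l)
      ≡⟨ cong₂ (λ y z → + 8 * N ^ 2 * S n₁ * -1ℤ ^ y * P ^ 2 * E z) h≡ (sym (cong (_∸ 3) p≡3+2l)) ⟩
    + 8 * N ^ 2 * S n₁ * -1ℤ ^ ((p ∸ 1) / 2) * P ^ 2 * E (p ∸ 3) ∎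
    where
    open Main {n′ = + suc n₁} cancels-1 (λ d → p∤n (∣⇒∣ᵤ d)) n₁ (sym (*-identityʳ (+ suc n₁)))
    open ≅-Reasoning (P ^ 3)
    instance
      l≢0 : NonZero l
      l≢0 = ℕ.≢-nonZero λ l≡0 → ℕ.<⇒≢ 3<p (sym (trans p≡3+2l (cong (λ z → 3 ℕ.+ (z ℕ.+ z)) l≡0)))
    Y : ℤ
    Y = N * (+ 2 * (N * N) * S (suc n₁) - + 5 * Q (suc n₁))
    κPP : ∀ {a c} → a ≅ c [ P ] → a * (P * P) ≅ c * (P * P) [ P ^ 3 ]
    κPP a≅c = ≅-weaken (divides 1ℤ (((∀ P → P * (P * P) ≡ 1ℤ * (P * (P * (P * 1ℤ)))) ∋ solve-∀) P))
      (*-≅-∣ a≅c (∣-refl {P * P}))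
    h≡ : h ≡ (p ∸ 1) / 2
    h≡ = trans (sym (ℕ.m*n/n≡m h 2)) (cong (_/ 2) (trans (ℕ.*-comm h 2)
      (trans (cong (h ℕ.+_) (ℕ.+-identityʳ h)) (sym (cong (_∸ 1) p≡1+2h)))))

  congruence-p≡3 : p ≡ 3 → ∀ n₁ → 3 ∤ suc n₁ →
    (b ⋆ b) (suc n₁ ℕ.* p) - (b ⋆ b) (suc n₁) ≅ + 9 * (+ suc n₁ - 1ℤ) * (b ⋆ b) (suc n₁) [ P ^ 3 ]
  congruence-p≡3 p≡3 n₁ 3∤n = begin
    S (suc n₁ ℕ.* p) - s
      ≈⟨ +-≅ S[np]≅ (≅-refl {a = - s}) ⟩
    s + P * P * (κ * (N * Y)) + + 4 * N * N * P * P * s₁ * τ - s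
      ≡⟨ cong₂ (λ y z → s + P * P * (y * (N * Y)) + + 4 * N * N * P * P * s₁ * z - s) κ≡-1 τ≡-1 ⟩
    s + P * P * (-1ℤ * (N * Y)) + + 4 * N * N * P * P * s₁ * -1ℤ - s
      ≡⟨ ((∀ P N s s₁ Y → s + P * P * (-1ℤ * (N * Y)) + + 4 * N * N * P * P * s₁ * -1ℤ - s
             ≡ P * P * ((N - 1ℤ) * s) + P * P * (- (N * Y) - + 4 * (N * N) * s₁ - (N - 1ℤ) * s)) ∋ solve-∀)
           P N s s₁ Y ⟩
    P * P * ((N - 1ℤ) * s) + P * P * residual N s s₁ (Q (suc n₁))
      ≡⟨ cong (λ z → P * P * ((N - 1ℤ) * s) + P * P * z) (_∣ℤ_.equality 3∣) ⟩
    P * P * ((N - 1ℤ) * s) + P * P * (quotient 3∣ * + 3)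
      ≡⟨ cong (λ z → P * P * ((N - 1ℤ) * s) + P * P * (quotient 3∣ * + z)) p≡3 ⟨
    P * P * ((N - 1ℤ) * s) + P * P * (quotient 3∣ * P)
      ≡⟨ ((∀ P a k → P * P * a + P * P * (k * P) ≡ P * P * a + k * (P * (P * (P * 1ℤ)))) ∋ solve-∀)
           P ((N - 1ℤ) * s) (quotient 3∣) ⟩
    P * P * ((N - 1ℤ) * s) + quotient 3∣ * P ^ 3
      ≈⟨ +-multiple-≅ (P * P * ((N - 1ℤ) * s)) (quotient 3∣) ⟩
    P * P * ((N - 1ℤ) * s)
      ≡⟨ cong (λ z → + z * + z * ((N - 1ℤ) * s)) p≡3 ⟩
    + 3 * + 3 * ((N - 1ℤ) * s)
      ≡⟨ ((∀ x y → + 3 * + 3 * (x * y) ≡ + 9 * x * y) ∋ solve-∀) (N - 1ℤ) s ⟩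
    + 9 * (N - 1ℤ) * s ∎
    where
    open Main {n′ = + suc n₁} cancels-1 (λ d → 3∤n (subst (_∣ suc n₁) p≡3 (∣⇒∣ᵤ d))) n₁ (sym (*-identityʳ (+ suc n₁)))
    open ≅-Reasoning (P ^ 3)
    s s₁ Y : ℤ
    s  = S (suc n₁)
    s₁ = S n₁
    Y  = + 2 * (N * N) * s - + 5 * Q (suc n₁)
    3∣ = 3∣residual n₁ 3∤n
    l≡0 : l ≡ 0
    l≡0 = ℕ.m+n≡0⇒m≡0 l (ℕ.+-cancelˡ-≡ 3 (l ℕ.+ l) 0 (trans (sym p≡3+2l) p≡3))
    -- With l = 0 the sums κ and τ have the single term s = 1, raised to the exponent 0.
    κ≡-1 : κ ≡ -1ℤ
    κ≡-1 = cong (λ l → ∑< (suc l) (λ i → - ((+ suc i) ^ (l ℕ.+ l)))) l≡0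
    τ≡-1 : τ ≡ -1ℤ
    τ≡-1 = cong (λ l → ∑< (suc l) (λ i → -1ℤ ^ suc i * (+ suc i) ^ (l ℕ.+ l))) l≡0

  cancels-^ : ∀ k → Cancels (P ^ k)
  cancels-^ zero    = cancels-1
  cancels-^ (suc k) = cancels-* (cancels-^ k)

  -- Both corrections contain N P², a multiple of P² q, so each needs one more P. In the τ term the
  -- second N supplies it. In the κ term it comes from Y, because 2 Q(n) is a multiple of N²; κ
  -- cannot supply it for p = 3, where it is -1.
  congruence-p∣n : ∀ n₁ → p ∣ suc n₁ → ∀ α → IsOrd p (suc n₁) α →
    (b ⋆ b) (suc n₁ ℕ.* p) - (b ⋆ b) (suc n₁) ≅ 0ℤ [ P ^ (3 ℕ.+ α) ]
  congruence-p∣n n₁ p∣n α (ℕ.divides c n≡c*q , maximal) = ≅0 (≅-∣ (+-≅ S[np]≅ (≅-refl {a = - S (suc n₁)}))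
    (∣-resp (((∀ s P K N Y S T → P * P * (K * (N * Y)) + N * N * (P * P) * (+ 4 * S * T)
                 ≡ s + P * P * (K * (N * Y)) + + 4 * N * N * P * P * S * T - s) ∋ solve-∀)
              (S (suc n₁)) P κ N Y (S n₁) τ)
      (∣m∣n⇒∣m+n (∣-resp (((∀ P K N Y → K * (N * (Y * (P * P))) ≡ P * P * (K * (N * Y))) ∋ solve-∀) P κ N Y)
                   (∣n⇒∣m*n κ (P³q∣ P∣Y)))
                 (∣m⇒∣m*n (+ 4 * S n₁ * τ) (∣-resp (sym (*-assoc N N (P * P))) (P³q∣ P∣N))))))
    where
    instance
      q≢0 : ℤ.NonZero (P ^ α)
      q≢0 = go α
        where
        go : ∀ k → ℤ.NonZero (P ^ k)
        go zero    = _
        go (suc k) = i*j≢0 P (P ^ k) {{P≢0}} {{go k}}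
    n≡ : + suc n₁ ≡ + c * P ^ α
    n≡ = trans (cong +_ n≡c*q) (trans (pos-* c (p ℕ.^ α)) (cong (+ c *_) (pos-^ p α)))
    P∤c : ¬ P ∣ℤ + c
    P∤c d with ∣⇒∣ᵤ d
    ... | ℕ.divides k refl = ℕ.1+n≰n (maximal (suc α)
      (ℕ.divides k (trans n≡c*q (ℕ.*-assoc k p (p ℕ.^ α)))))
    open Main {n′ = + c} (cancels-^ α) P∤c n₁ n≡
    Y : ℤ
    Y = + 2 * (N * N) * S (suc n₁) - + 5 * Q (suc n₁)
    P∣N : P ∣ℤ N
    P∣N = ∣ᵤ⇒∣ p∣n
    P∣Q : P ∣ℤ Q (suc n₁)
    P∣Q = cancels-P (+ 2) P∤2 (∣-resp (sym (2Q n₁)) (∣m⇒∣m*n (S (suc n₁) - + 4 * S n₁) (∣m⇒∣m*n N P∣N)))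
    P∣Y : P ∣ℤ Y
    P∣Y = ∣m∣n⇒∣m-n (∣m⇒∣m*n (S (suc n₁)) (∣n⇒∣m*n (+ 2) (∣m⇒∣m*n N P∣N))) (∣n⇒∣m*n (+ 5) P∣Q)
    P³q∣ : ∀ {y} → P ∣ℤ y → P ^ (3 ℕ.+ α) ∣ℤ N * (y * (P * P))
    P³q∣ (divides k refl) = divides (+ c * k) (trans (cong (λ z → z * (k * P * (P * P))) n≡)
      (((∀ c q k P → c * q * (k * P * (P * P)) ≡ c * k * (P * (P * (P * q)))) ∋ solve-∀) (+ c) (P ^ α) k P))

theorem3p1 :
    ∀ (S E : ℕ → ℤ) → IsAperyLikeS S → IsEuler E →
    ∀ (p : ℕ) → Prime p → 2 ∤ p →
    ∀ (n : ℕ) .{{_ : NonZero n}} →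
      (p > 3 → p ∤ n →
        S (n ℕ.* p) - S n
          ≡ + 8 * (+ n) ^ 2 * S (pred n) * -1ℤ ^ ((p ∸ 1) / 2) * (+ p) ^ 2 * E (p ∸ 3)
          [mod p ℕ.^ 3 ])
      × (p ≡ 3 → 3 ∤ n →
        S (n ℕ.* p) - S n ≡ + 9 * (+ n - 1ℤ) * S n [mod p ℕ.^ 3 ])
      × (p ∣ n → ∀ α → IsOrd p n α →
        S (n ℕ.* p) - S n ≡ 0ℤ [mod p ℕ.^ (3 ℕ.+ α) ])
theorem3p1 S E isS isEuler p p-prime 2∤p (suc n₁) =
    (λ 3<p p∤n → ≅⇒≡mod (pos-^ p 3) (≅-trans S-S (≅-trans
      (OddPrime.congruence-p>3 p l p-prime p≡3+2l isEuler 3<p n₁ p∤n)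
      (≅-reflexive (cong (λ z → + 8 * (+ suc n₁) ^ 2 * z * -1ℤ ^ ((p ∸ 1) / 2) * (+ p) ^ 2 * E (p ∸ 3)) (sym (S≗ n₁))))))) ,
    (λ p≡3 3∤n → ≅⇒≡mod (pos-^ p 3) (≅-trans S-S (≅-trans
      (OddPrime.congruence-p≡3 p l p-prime p≡3+2l p≡3 n₁ 3∤n)
      (≅-reflexive (cong (λ z → + 9 * (+ suc n₁ - 1ℤ) * z) (sym (S≗ (suc n₁)))))))) ,
    (λ p∣n α isOrd → ≅⇒≡mod (pos-^ p (3 ℕ.+ α)) (≅-trans S-S
      (OddPrime.congruence-p∣n p l p-prime p≡3+2l n₁ p∣n α isOrd)))
  where
  l : ℕ
  l = proj₁ (oddPrime⇒3+2l p p-prime 2∤p)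
  p≡3+2l : p ≡ 3 ℕ.+ (l ℕ.+ l)
  p≡3+2l = proj₂ (oddPrime⇒3+2l p p-prime 2∤p)
  S≗ : S ≗ b ⋆ b
  S≗ = IsAperyLikeS⇒b⋆b isS
  S-S : ∀ {M} → S (suc n₁ ℕ.* p) - S (suc n₁) ≅ (b ⋆ b) (suc n₁ ℕ.* p) - (b ⋆ b) (suc n₁) [ M ]
  S-S = ≅-reflexive (cong₂ _-_ (S≗ (suc n₁ ℕ.* p)) (S≗ (suc n₁)))
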